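{- Let $Q$ be an $n$-element poset. The following conditions are equivalent: (a) The flag $h$-vector $\beta_{J(Q)}$ of $J(Q)$ is multiplicity-free (in which case, if $\beta_{J(Q)}(S)\ne0$ then $S$ is sparse). (b) For $0\le i\le n$, $J(Q)$ has at most two elements of rank $i$; equivalently, $Q$ has at most two $i$-element order ideals. (c) $Q$ is $(\mathbf{2}+\mathbf{2})$-free and $(\mathbf{1}+\mathbf{1}+\mathbf{1})$-free. Moreover, if $f(n)$ is the number of nonisomorphic $n$-element posets satisfying these conditions (with $f(0)=1$), then $$\sum_{n\ge0}f(n)x^n=\frac{1-2x}{(1-x)(1-2x-x^2)}.$$ If $g(n)$ is the number of such $n$-element posets which are not a nontrivial ordinal sum (equivalently, $J(Q)$ has exactly two elements of each rank $1\le i\le n-1$), then $g(1)=g(2)=1$ and $g(n)=2^{n-3}$ for $n\ge3$.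
   Context: $J(Q)$ is the distributive lattice of order ideals of $Q$ ordered by inclusion; it is graded of rank $n$ with rank function $I\mapsto \#I$, $\hat0=\emptyset$, $\hat1=Q$. For a finite graded poset $P$ of rank $n$ with $\hat0,\hat1$ and rank function $\rho$, the flag $f$-vector is $\alpha_P(S)=$ number of chains $C$ with $\{\rho(t):t\in C\}=S$ ($S\subseteq[n-1]$), and the flag $h$-vector is $\beta_P(S)=\sum_{T\subseteq S}(-1)^{\#(S-T)}\alpha_P(T)$; $\beta_P$ is multiplicity-free if all its values lie in $\{0,\pm1\}$. A set of integers is sparse if it contains no two consecutive integers. A poset is $(\mathbf{2}+\mathbf{2})$-free if it has no induced subposet isomorphic to a disjoint union of two 2-element chains, and $(\mathbf{1}+\mathbf{1}+\mathbf{1})$-free if it has no 3-element antichain. The ordinal sum $Q_1\oplus Q_2$ is the disjoint union with all relations of $Q_1$, of $Q_2$, and $s<t$ for all $s\in Q_1,t\in Q_2$; it is nontrivial if both $Q_1,Q_2$ are nonempty. -}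

module Defs where

open import Data.Bool using (Bool; true; false; _∧_; _∨_; not; T)
open import Data.Nat as ℕ using (ℕ; zero; suc; _∸_; _≡ᵇ_; _≤_)
open import Data.Integer as ℤ using (ℤ; +_; -_)
open import Data.Fin using (Fin; toℕ)
open import Data.Fin.Subset using (Subset; _∈_; _∉_; _⊆_; ∣_∣; ⊥; Nonempty)
open import Data.Fin.Subset.Properties using (_⊆?_)
open import Data.Vec using (Vec; []; _∷_; lookup)
open import Data.List as L using (List; []; _∷_; map; filter; allFin; length; _++_)
open import Data.List.Relation.Unary.All using (All)
import Data.Bool.ListAction as BL
import Data.Nat.ListAction as NL
open import Data.List.Relation.Unary.Any using (Any)
open import Data.List.Relation.Unary.AllPairs using (AllPairs)
open import Data.Product using (Σ; ∃; ∃-syntax; _×_; _,_)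
open import Data.Sum using (_⊎_)
open import Function.Bundles using (_↔_; Inverse)
open import Relation.Nullary using (¬_; ⌊_⌋)
open import Relation.Binary.PropositionalEquality using (_≡_)

Rel : ℕ → Set
Rel n = Fin n → Fin n → Bool

record IsPoset {n : ℕ} (le : Rel n) : Set where
  field
    reflexive : ∀ x → T (le x x)
    antisym   : ∀ x y → T (le x y) → T (le y x) → x ≡ y
    trans     : ∀ x y z → T (le x y) → T (le y z) → T (le x z)

record Poset (n : ℕ) : Set where
  constructor poset
  field
    le      : Rel n
    isPoset : IsPoset le

open Poset public

_<[_]_ : {n : ℕ} → Fin n → Poset n → Fin n → Set
x <[ Q ] y = T (le Q x y) × ¬ (x ≡ y)

Incomparable : {n : ℕ} → Poset n → Fin n → Fin n → Set
Incomparable Q x y = ¬ T (le Q x y) × ¬ T (le Q y x)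

_≅_ : {n m : ℕ} → Rel n → Rel m → Set
_≅_ {n} {m} R R' =
  Σ (Fin n ↔ Fin m) λ σ → ∀ x y → R x y ≡ R' (Inverse.to σ x) (Inverse.to σ y)

IsoClassCount : (n : ℕ) → (Poset n → Set) → ℕ → Set
IsoClassCount n P k =
  Σ (List (Poset n)) λ Ls →
    length Ls ≡ k
    × All P Ls
    × AllPairs (λ Q Q' → ¬ (le Q ≅ le Q')) Ls
    × (∀ (Q : Poset n) → P Q → Any (λ Q' → le Q ≅ le Q') Ls)

TwoPlusTwoFree : {n : ℕ} → Poset n → Set
TwoPlusTwoFree Q = ¬ (∃[ a ] ∃[ b ] ∃[ c ] ∃[ d ]
  (a <[ Q ] b × c <[ Q ] d
   × Incomparable Q a c × Incomparable Q a d
   × Incomparable Q b c × Incomparable Q b d))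

OnePlusOnePlusOneFree : {n : ℕ} → Poset n → Set
OnePlusOnePlusOneFree Q = ¬ (∃[ a ] ∃[ b ] ∃[ c ]
  (Incomparable Q a b × Incomparable Q a c × Incomparable Q b c))

_⊕_ : {m k : ℕ} → Rel m → Rel k → Rel (m ℕ.+ k)
_⊕_ {m} {k} R₁ R₂ x y with Data.Fin.splitAt m x | Data.Fin.splitAt m y
... | Data.Sum.inj₁ a | Data.Sum.inj₁ b = R₁ a b
... | Data.Sum.inj₁ a | Data.Sum.inj₂ b = true
... | Data.Sum.inj₂ a | Data.Sum.inj₁ b = false
... | Data.Sum.inj₂ a | Data.Sum.inj₂ b = R₂ a b

IsNontrivialOrdinalSum : {n : ℕ} → Poset n → Set
IsNontrivialOrdinalSum Q =
  ∃[ m ] ∃[ k ] Σ (Poset (suc m)) λ Q₁ → Σ (Poset (suc k)) λ Q₂ →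
    (le Q₁ ⊕ le Q₂) ≅ le Q

allSubsets : (n : ℕ) → List (Subset n)
allSubsets zero = [] ∷ []
allSubsets (suc n) = map (false ∷_) (allSubsets n) ++ map (true ∷_) (allSubsets n)

IsOrderIdealᵇ : {n : ℕ} → Poset n → Subset n → Bool
IsOrderIdealᵇ {n} Q I =
  BL.all (λ y → BL.all (λ x → not (lookup I y ∧ le Q x y) ∨ lookup I x) (allFin n)) (allFin n)

orderIdeals : {n : ℕ} → Poset n → List (Subset n)
orderIdeals {n} Q = filter (λ I → T? (IsOrderIdealᵇ Q I)) (allSubsets n)
  where
  open import Relation.Nullary.Decidable using () renaming (T? to T?)

rankCount : {n : ℕ} → Poset n → ℕ → ℕ
rankCount Q i = length (filter (λ I → ∣ I ∣ ℕ.≟ i) (orderIdeals Q))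

-- Flag f- and h-vectors of J(Q).
-- A subset S ⊆ [n-1] = {1,…,n-1} is represented as S : Subset (n ∸ 1),
-- index i : Fin (n ∸ 1) standing for the rank (toℕ i + 1).

rankList : {m : ℕ} → Subset m → List ℕ
rankList {m} S = map (λ i → suc (toℕ i)) (filter (λ i → i Data.Fin.Subset.Properties.∈? S) (allFin m))

-- number of chains I₁ ⊆ I₂ ⊆ … of order ideals (strictly increasing ranks rs),
-- each containing J, with #Iⱼ = the j-th entry of rs
countChains : {n : ℕ} → Poset n → List ℕ → Subset n → ℕ
countChains Q [] J = 1
countChains Q (r ∷ rs) J =
  NL.sum (map (countChains Q rs)
    (filter (λ I → (∣ I ∣ ℕ.≟ r) Relation.Nullary.×-dec (J ⊆? I)) (orderIdeals Q)))

flagF : {n : ℕ} → Poset n → Subset (n ∸ 1) → ℕ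
flagF Q S = countChains Q (rankList S) ⊥

signPow : ℕ → ℤ
signPow zero = + 1
signPow (suc k) = - signPow k

flagH : {n : ℕ} → Poset n → Subset (n ∸ 1) → ℤ
flagH {n} Q S =
  L.foldr ℤ._+_ (+ 0)
    (map (λ T' → signPow (∣ S Data.Fin.Subset.─ T' ∣) ℤ.* (+ flagF Q T'))
      (filter (λ T' → T' ⊆? S) (allSubsets (n ∸ 1))))

MultiplicityFree : {n : ℕ} → Poset n → Set
MultiplicityFree {n} Q =
  ∀ (S : Subset (n ∸ 1)) → (flagH Q S ≡ + 0) ⊎ (flagH Q S ≡ + 1) ⊎ (flagH Q S ≡ - (+ 1))

Sparse : {m : ℕ} → Subset m → Set
Sparse {m} S = ∀ (i j : Fin m) → toℕ j ≡ suc (toℕ i) → i ∈ S → j ∈ S → Data.Empty.⊥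
  where import Data.Empty

Series : Set
Series = ℕ → ℤ

poly : List ℤ → Series
poly [] _ = + 0
poly (c ∷ cs) zero = c
poly (c ∷ cs) (suc k) = poly cs k

_*ₛ_ : Series → Series → Series
(F *ₛ G) N = go N N
  where
  go : ℕ → ℕ → ℤ
  go zero N = F 0 ℤ.* G N
  go (suc k) N = go k N ℤ.+ F (suc k) ℤ.* G (N ∸ suc k)

AtMostTwoPerRank : {n : ℕ} → Poset n → Set
AtMostTwoPerRank {n} Q = ∀ (i : ℕ) → i ≤ n → rankCount Q i ≤ 2

ForbiddenFree : {n : ℕ} → Poset n → Set
ForbiddenFree Q = TwoPlusTwoFree Q × OnePlusOnePlusOneFree Q

NotOrdinalSumCond : {n : ℕ} → Poset n → Set
NotOrdinalSumCond Q = ForbiddenFree Q × ¬ IsNontrivialOrdinalSum Q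

{-# OPTIONS --safe #-}

-- (a) ⇔ (b).  For increasing ranks r ∷ rs and an ideal J let h (r ∷ rs) J = Σ h rs I − h rs J, the sum
-- running over the ideals I ⊇ J of rank r; then β(S) = h S ∅, and β({i}) is one less than the number of
-- ideals of rank i.  Suppose no rank has three ideals.  If only one I of rank r contains J, then I and J
-- lie below the same ideals of higher rank and h (r ∷ rs) J = 0.  If there are two, then one of them, M,
-- lies below all ideals of rank r + 1, so h rs M = h rs J and h (r ∷ rs) J = h rs N for the other one, N.
-- Hence h takes only the values 0 and 1, and h (r ∷ rs) J = 0 if rs begins with r + 1.
--
-- (b) ⇔ (c).  For ideals X and Y, every element of X ∖ Y is incomparable to every element of Y ∖ X.  So
-- under (c) two ideals of equal size differ by exchanging one element, and three of them would exhibit a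
-- 3-antichain.  Conversely, if X ∖ Y and Y ∖ X both have two elements, there are three ideals of size
-- |X ∩ Y| + 2; a 2+2 gives such X and Y as principal ideals.
--
-- Counting.  A poset as in (c) has a maximal element y above everything except possibly one other maximal
-- element x; conversely, adjoining such a y to a poset as in (c) gives another one.  If Q has a greatest
-- element, or two maximal elements with the same elements below them, then up to isomorphism there is one
-- choice for x, otherwise there are two.  This yields a tree with three kinds of nodes whose level sizes
-- satisfy a linear recurrence.  Q is a nontrivial ordinal sum exactly if some element other than the first
-- is adjoined above everything.
module Submission where

open import Defs
open import Data.Bool as 𝔹 using (Bool; true; false; _∧_; _∨_; not; T)
open import Data.Bool.Properties using (T?; T-≡)
open import Data.Empty using (⊥; ⊥-elim)
open import Data.Nat as ℕ using (ℕ; zero; suc; _≤_; _<_; _+_; _∸_; _^_; z≤n; s≤s)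
import Data.Nat.ListAction as NL
import Data.Nat.Properties as ℕₚ
import Data.Nat.Tactic.RingSolver as ℕ-Solver
open import Data.Integer as ℤ using (ℤ; +_; -_)
import Data.Integer.Properties as ℤₚ
import Data.Integer.Tactic.RingSolver as ℤ-Solver
open import Data.Fin using (Fin; zero; suc; toℕ; fromℕ<; splitAt; _↑ʳ_; punchIn; punchOut)
import Data.Fin.Permutation as Perm
import Data.Fin.Properties as Finₚ
open import Data.Fin.Subset using (Subset; _∈_; _∉_; _⊆_; _∩_; _∪_; _─_; ∣_∣; ⁅_⁆) renaming (⊥ to ∅; ⊤ to full)
open import Data.Fin.Subset.Properties
open import Data.Vec using ([]; _∷_; lookup; tabulate; here; there)
open import Data.Vec.Properties using (lookup∘tabulate; lookup⇒[]=; []=⇒lookup; ∷-injectiveʳ; ≡-dec)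
open import Data.List as L using (List; []; _∷_; _++_; length; map; filter; allFin)
open import Data.List.Properties using (map-∘; map-cong; map-++; filter-++; filter-none; filter-all; length-map; length-++)
open import Data.List.Membership.Propositional using () renaming (_∈_ to _∈ₗ_)
import Data.List.Membership.Propositional.Properties as Memₚ
open import Data.List.Relation.Binary.Disjoint.Propositional using (Disjoint)
open import Data.List.Relation.Unary.All as All using (All; []; _∷_)
import Data.List.Relation.Unary.All.Properties as Allₚ
open import Data.List.Relation.Unary.AllPairs as AllPairs using ([]; _∷_)
import Data.List.Relation.Unary.AllPairs.Properties as AllPairsₚ
open import Data.List.Relation.Unary.Any as Any using (here; there)
import Data.List.Relation.Unary.Any.Properties as Anyₚ
open import Data.List.Relation.Unary.Linked as Linked using (Linked; []; [-]; _∷_)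
open import Data.List.Relation.Unary.Unique.Propositional using (Unique)
import Data.List.Relation.Unary.Unique.Propositional.Properties as Uniqueₚ
open import Data.Maybe as Maybe using (Maybe; just; nothing)
open import Data.Maybe.Relation.Unary.All as MAll using (just; nothing)
open import Data.Product using (Σ; ∃; ∃-syntax; _×_; _,_; proj₁; proj₂)
open import Data.Sum as Sum using (_⊎_; inj₁; inj₂)
open import Function using (_∘_; flip; id)
open import Function.Bundles using (_⇔_; _↔_; mk⇔; mk↔ₛ′; Equivalence; Inverse)
open import Function.Construct.Composition using (_↔-∘_)
open import Function.Construct.Identity using (↔-id)
open import Function.Construct.Symmetry using (⇔-sym; ↔-sym)
open import Function.Definitions using (Injective)
open import Relation.Binary.PropositionalEquality using (_≡_; _≢_; refl; sym; trans; cong; cong₂; subst; subst₂; ≢-sym; module ≡-Reasoning)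
open import Relation.Nullary using (¬_; Dec; yes; no; contradiction; ¬?; _×-dec_)
open import Relation.Nullary.Decidable using (decidable-stable; ⌊_⌋; toWitness; fromWitness; _⊎-dec_)
open import Relation.Unary using (Decidable)

open Equivalence using (to; from)

private
  variable
    n m : ℕ
    X Y : Set

-- Order ideals

∈-tabulate⁺ : (f : Fin n → Bool) {x : Fin n} → T (f x) → x ∈ tabulate f
∈-tabulate⁺ f {x} t = lookup⇒[]= x _ (trans (lookup∘tabulate f x) (T-≡ .to t))

∈-tabulate⁻ : (f : Fin n → Bool) {x : Fin n} → x ∈ tabulate f → T (f x)
∈-tabulate⁻ f {x} x∈ = T-≡ .from (trans (sym (lookup∘tabulate f x)) ([]=⇒lookup x∈))

∉⇒T-not : {p : Subset n} {x : Fin n} → x ∉ p → T (not (lookup p x))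
∉⇒T-not {p = p} {x} x∉p with lookup p x in eq
... | true  = x∉p (lookup⇒[]= x p eq)
... | false = _

⊈⇒∃ : {p q : Subset n} → ¬ (p ⊆ q) → ∃[ x ] (x ∈ p × x ∉ q)
⊈⇒∃ {p = p} {q} p⊈q with Finₚ.any? (λ x → (x ∈? p) ×-dec ¬? (x ∈? q))
... | yes found = found
... | no none   = contradiction
  (λ {x} x∈p → decidable-stable (x ∈? q) (λ x∉q → none (x , x∈p , x∉q))) p⊈q

∣p∣<∣q∣⇒∃ : {p q : Subset n} → ∣ p ∣ < ∣ q ∣ → ∃[ x ] (x ∈ q × x ∉ p)
∣p∣<∣q∣⇒∃ p<q = ⊈⇒∃ (λ q⊆p → ℕₚ.<⇒≱ p<q (p⊆q⇒∣p∣≤∣q∣ q⊆p))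

⊆∧∣q∣≤∣p∣⇒≡ : {p q : Subset n} → p ⊆ q → ∣ q ∣ ≤ ∣ p ∣ → p ≡ q
⊆∧∣q∣≤∣p∣⇒≡ {p = p} {q} p⊆q q≤p with q ⊆? p
... | yes q⊆p = ⊆-antisym p⊆q q⊆p
... | no  q⊈p = contradiction (p⊂q⇒∣p∣<∣q∣ (p⊆q , ⊈⇒∃ q⊈p)) (ℕₚ.≤⇒≯ q≤p)

∣p∪⁅x⁆∣≡1+∣p∣ : (p : Subset n) (x : Fin n) → x ∉ p → ∣ p ∪ ⁅ x ⁆ ∣ ≡ suc ∣ p ∣
∣p∪⁅x⁆∣≡1+∣p∣ (true  ∷ p) zero    x∉p = contradiction here x∉p
∣p∪⁅x⁆∣≡1+∣p∣ (false ∷ p) zero    x∉p = cong (suc ∘ ∣_∣) (∪-identityʳ p)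
∣p∪⁅x⁆∣≡1+∣p∣ (true  ∷ p) (suc x) x∉p = cong suc (∣p∪⁅x⁆∣≡1+∣p∣ p x (x∉p ∘ there))
∣p∪⁅x⁆∣≡1+∣p∣ (false ∷ p) (suc x) x∉p = ∣p∪⁅x⁆∣≡1+∣p∣ p x (x∉p ∘ there)

2+∣p∣≤∣q∣ : {p q : Subset n} {a b : Fin n} → p ⊆ q → a ≢ b → a ∈ q → a ∉ p → b ∈ q → b ∉ p →
  suc (suc ∣ p ∣) ≤ ∣ q ∣
2+∣p∣≤∣q∣ {p = p} {q} {a} {b} p⊆q a≢b a∈q a∉p b∈q b∉p =
  subst (λ k → suc k ≤ ∣ q ∣) (∣p∪⁅x⁆∣≡1+∣p∣ p a a∉p)
    (p⊂q⇒∣p∣<∣q∣ (p∪a⊆q , b , b∈q , b∉p∪a))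
  where
  p∪a⊆q : p ∪ ⁅ a ⁆ ⊆ q
  p∪a⊆q x∈ with x∈p∪q⁻ p ⁅ a ⁆ x∈
  ... | inj₁ x∈p = p⊆q x∈p
  ... | inj₂ x∈a = subst (_∈ q) (sym (x∈⁅y⁆⇒x≡y a x∈a)) a∈q
  b∉p∪a : b ∉ p ∪ ⁅ a ⁆
  b∉p∪a b∈ with x∈p∪q⁻ p ⁅ a ⁆ b∈
  ... | inj₁ b∈p = b∉p b∈p
  ... | inj₂ b∈a = a≢b (sym (x∈⁅y⁆⇒x≡y a b∈a))

flip-isPoset : {R : Rel n} → IsPoset R → IsPoset (flip R)
flip-isPoset P = record
  { reflexive = reflexive
  ; antisym   = λ x y p q → antisym x y q p
  ; trans     = λ x y z p q → trans' z y x q p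
  } where open IsPoset P renaming (trans to trans')

module _ {R : Rel n} (P : IsPoset R) (p : Fin n → Bool) where
  open IsPoset P renaming (trans to ≤-trans; antisym to ≤-antisym; reflexive to ≤-refl)

  private
    -- Scan the list, replacing the candidate `y` by any smaller element that satisfies `p`. The new
    -- candidate `w` stays minimal over the part already scanned: a `z` there below `w` is below
    -- `y`, hence equal to `y`, and antisymmetry with `w ≤ y` gives `z ≡ w`.
    minimal-in : (xs : List (Fin n)) (x : Fin n) → T (p x) →
      ∃[ y ] (T (p y) × T (R y x) × (∀ {z} → z ∈ₗ xs → T (p z) → T (R z y) → z ≡ y))
    minimal-in []       x px = x , px , ≤-refl x , λ ()
    minimal-in (w ∷ xs) x px with minimal-in xs x px
    ... | y , py , y≤x , min with T? (p w) ×-dec T? (R w y)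
    ... | yes (pw , w≤y) = w , pw , ≤-trans w y x w≤y y≤x , λ
      { (here z≡w) _ _ → z≡w
      ; {z} (there z∈) pz z≤w → ≤-antisym z w z≤w
          (subst (T ∘ R w) (sym (min z∈ pz (≤-trans z w y z≤w w≤y))) w≤y) }
    ... | no ¬w = y , py , y≤x , λ
      { (here refl) pz z≤y → contradiction (pz , z≤y) ¬w
      ; (there z∈) → min z∈ }

  -- Applied to the flipped order, this also supplies maximal elements.
  minimal-below : (x : Fin n) → T (p x) →
    ∃[ y ] (T (p y) × T (R y x) × (∀ {z} → T (p z) → T (R z y) → z ≡ y))
  minimal-below x px with minimal-in (allFin n) x px
  ... | y , py , y≤x , min = y , py , y≤x , λ {z} → min (Memₚ.∈-allFin z)

Maximal : Rel n → Fin n → Set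
Maximal R x = ∀ {y} → T (R x y) → y ≡ x

IsIdeal : Poset n → Subset n → Set
IsIdeal Q I = ∀ {x y} → T (le Q x y) → y ∈ I → x ∈ I

∈-allSubsets : (p : Subset n) → p ∈ₗ allSubsets n
∈-allSubsets []          = here refl
∈-allSubsets (false ∷ p) = Memₚ.∈-++⁺ˡ (Memₚ.∈-map⁺ (false ∷_) (∈-allSubsets p))
∈-allSubsets (true  ∷ p) = Memₚ.∈-++⁺ʳ _ (Memₚ.∈-map⁺ (true ∷_) (∈-allSubsets p))

allSubsets-unique : ∀ n → Unique (allSubsets n)
allSubsets-unique zero    = [] ∷ []
allSubsets-unique (suc n) = Uniqueₚ.++⁺
  (Uniqueₚ.map⁺ ∷-injectiveʳ (allSubsets-unique n))
  (Uniqueₚ.map⁺ ∷-injectiveʳ (allSubsets-unique n))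
  λ (v∈₁ , v∈₂) → disjoint v∈₁ v∈₂
  where
  disjoint : ∀ {v xs ys} → v ∈ₗ L.map (false ∷_) xs → v ∈ₗ L.map (true ∷_) ys → ⊥
  disjoint v∈₁ v∈₂ with Memₚ.∈-map⁻ _ v∈₁ | Memₚ.∈-map⁻ _ v∈₂
  ... | _ , _ , refl | _ , _ , ()

module _ (Q : Poset n) where
  open IsPoset (isPoset Q) renaming (trans to ≤-trans; antisym to ≤-antisym; reflexive to ≤-refl)

  private
    entry⁻ : ∀ {I : Subset n} {x y} → T (not (lookup I y ∧ le Q x y) ∨ lookup I x) →
      T (le Q x y) → y ∈ I → x ∈ I
    entry⁻ {I} {x} {y} t x≤y y∈I with lookup I y in eqy | le Q x y | lookup I x in eqx
    ... | true  | true | true = lookup⇒[]= x I eqx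
    ... | false | _    | _    = contradiction (trans (sym eqy) ([]=⇒lookup y∈I)) λ ()

    entry⁺ : ∀ {I : Subset n} {x y} → (T (le Q x y) → y ∈ I → x ∈ I) →
      T (not (lookup I y ∧ le Q x y) ∨ lookup I x)
    entry⁺ {I} {x} {y} f with lookup I y in eqy | le Q x y | lookup I x in eqx
    ... | false | _     | _     = _
    ... | true  | false | _     = _
    ... | true  | true  | true  = _
    ... | true  | true  | false =
      contradiction (trans (sym eqx) ([]=⇒lookup (f _ (lookup⇒[]= y I eqy)))) λ ()

  IsOrderIdealᵇ-sound : ∀ {I} → T (IsOrderIdealᵇ Q I) → IsIdeal Q I
  IsOrderIdealᵇ-sound {I} t {x} {y} = entry⁻
    (All.lookup (Allₚ.all⁺ _ (allFin n) (All.lookup (Allₚ.all⁺ _ (allFin n) t) (Memₚ.∈-allFin y))) (Memₚ.∈-allFin x))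

  IsOrderIdealᵇ-complete : ∀ {I} → IsIdeal Q I → T (IsOrderIdealᵇ Q I)
  IsOrderIdealᵇ-complete {I} ideal =
    Allₚ.all⁻ _ (All.tabulate {xs = allFin n} λ {y} _ →
      Allₚ.all⁻ _ (All.tabulate {xs = allFin n} λ {x} _ → entry⁺ {I} {x} {y} ideal))

  level : ℕ → List (Subset n)
  level r = filter (λ I → ∣ I ∣ ℕ.≟ r) (orderIdeals Q)

  ∈-level⁺ : ∀ {I} → IsIdeal Q I → I ∈ₗ level ∣ I ∣
  ∈-level⁺ {I} ideal = Memₚ.∈-filter⁺ (λ I → ∣ I ∣ ℕ.≟ _)
    (Memₚ.∈-filter⁺ _ (∈-allSubsets I) (IsOrderIdealᵇ-complete ideal)) refl

  ∈-level⁻ : ∀ {I r} → I ∈ₗ level r → IsIdeal Q I × ∣ I ∣ ≡ r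
  ∈-level⁻ {I} {r} I∈ with Memₚ.∈-filter⁻ (λ I → ∣ I ∣ ℕ.≟ r) {xs = orderIdeals Q} I∈
  ... | I∈J , eq = (λ {x} {y} → IsOrderIdealᵇ-sound (proj₂ (Memₚ.∈-filter⁻ _ {xs = allSubsets n} I∈J)) {x} {y}) , eq

  level-unique : ∀ r → Unique (level r)
  level-unique r = Uniqueₚ.filter⁺ _ (Uniqueₚ.filter⁺ _ (allSubsets-unique n))

  ∅-ideal : IsIdeal Q ∅
  ∅-ideal _ y∈ = contradiction y∈ ∉⊥

  full-ideal : IsIdeal Q full
  full-ideal _ _ = ∈⊤

  ∩-ideal : ∀ {I J} → IsIdeal Q I → IsIdeal Q J → IsIdeal Q (I ∩ J)
  ∩-ideal {I} {J} idI idJ x≤y y∈ with x∈p∩q⁻ I J y∈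
  ... | y∈I , y∈J = x∈p∩q⁺ (idI x≤y y∈I , idJ x≤y y∈J)

  ∪-ideal : ∀ {I J} → IsIdeal Q I → IsIdeal Q J → IsIdeal Q (I ∪ J)
  ∪-ideal {I} {J} idI idJ x≤y y∈ with x∈p∪q⁻ I J y∈
  ... | inj₁ y∈I = x∈p∪q⁺ (inj₁ (idI x≤y y∈I))
  ... | inj₂ y∈J = x∈p∪q⁺ (inj₂ (idJ x≤y y∈J))

  ↓_ : Fin n → Subset n
  ↓ b = tabulate (λ x → le Q x b)

  ↓-ideal : ∀ b → IsIdeal Q (↓ b)
  ↓-ideal b {x} {y} x≤y y∈ = ∈-tabulate⁺ _ (≤-trans x y b x≤y (∈-tabulate⁻ _ y∈))

  Between : Subset n → ℕ → Subset n → Set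
  Between J r K = ∃[ I ] (IsIdeal Q I × ∣ I ∣ ≡ r × J ⊆ I × I ⊆ K)

  -- Adjoin to `J` a minimal element `y` of its complement, chosen below some element of `K` outside
  -- `J`. Minimality makes the union an ideal, and `K` contains `y` because it is closed downwards.
  between-suc : ∀ {J K} → IsIdeal Q J → IsIdeal Q K → J ⊆ K → ∣ J ∣ < ∣ K ∣ → Between J (suc ∣ J ∣) K
  between-suc {J} {K} idJ idK J⊆K J<K with ∣p∣<∣q∣⇒∃ {p = J} {K} J<K
  ... | x , x∈K , x∉J with minimal-below (isPoset Q) (λ z → not (lookup J z)) x (∉⇒T-not {p = J} x∉J)
  ... | y , y∉ , y≤x , min = J ∪ ⁅ y ⁆ , ideal , ∣p∪⁅x⁆∣≡1+∣p∣ J y y∉J , p⊆p∪q _ , sub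
    where
    y∉J : y ∉ J
    y∉J y∈J = subst (T ∘ not) ([]=⇒lookup y∈J) y∉
    ideal : IsIdeal Q (J ∪ ⁅ y ⁆)
    ideal {w} {z} w≤z z∈ with x∈p∪q⁻ J ⁅ y ⁆ z∈
    ... | inj₁ z∈J = x∈p∪q⁺ (inj₁ (idJ w≤z z∈J))
    ... | inj₂ z∈y with x∈⁅y⁆⇒x≡y y z∈y | lookup J w in eq
    ... | refl | true  = x∈p∪q⁺ (inj₁ (lookup⇒[]= w J eq))
    ... | refl | false = x∈p∪q⁺ (inj₂ (subst (_∈ ⁅ y ⁆) (sym (min (subst (T ∘ not) (sym eq) _) w≤z)) (x∈⁅x⁆ y)))
    sub : J ∪ ⁅ y ⁆ ⊆ K
    sub z∈ with x∈p∪q⁻ J ⁅ y ⁆ z∈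
    ... | inj₁ z∈J = J⊆K z∈J
    ... | inj₂ z∈y = idK (subst (λ z → T (le Q z x)) (sym (x∈⁅y⁆⇒x≡y y z∈y)) y≤x) x∈K

  between : ∀ {J K r} → IsIdeal Q J → IsIdeal Q K → J ⊆ K → ∣ J ∣ ≤ r → r ≤ ∣ K ∣ → Between J r K
  between {J} {K} {r} idJ idK J⊆K J≤r r≤K = go (r ∸ ∣ J ∣) idJ J⊆K (ℕₚ.m∸n+n≡m J≤r)
    where
    go : ∀ d {J} → IsIdeal Q J → J ⊆ K → d + ∣ J ∣ ≡ r → Between J r K
    go zero {J} idJ J⊆K eq = J , idJ , eq , (λ x∈ → x∈) , J⊆K
    go (suc d) {J} idJ J⊆K eq
      with between-suc idJ idK J⊆K (ℕₚ.<-≤-trans (subst (∣ J ∣ <_) eq (s≤s (ℕₚ.m≤n+m ∣ J ∣ d))) r≤K)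
    ... | J' , idJ' , J'≡ , J⊆J' , J'⊆K
      with go d idJ' J'⊆K (trans (trans (cong (λ k → d + k) J'≡) (ℕₚ.+-suc d ∣ J ∣)) eq)
    ... | I , idI , I≡ , J'⊆I , I⊆K = I , idI , I≡ , J'⊆I ∘ J⊆J' , I⊆K

  -- Condition (b) freed from lists and counting. Both directions of (b) ⇔ (c) and the analysis of
  -- the flag h-vector use this form.
  NoThree : Set
  NoThree = ∀ {A B C} → IsIdeal Q A → IsIdeal Q B → IsIdeal Q C → ∣ A ∣ ≡ ∣ B ∣ → ∣ A ∣ ≡ ∣ C ∣ →
    A ≢ B → A ≢ C → B ≢ C → ⊥

  atMostTwo⇒noThree : AtMostTwoPerRank Q → NoThree
  atMostTwo⇒noThree two {A} {B} {C} idA idB idC A≡B A≡C A≢B A≢C B≢C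
    with level ∣ A ∣ | ∈-level⁺ idA
       | subst (λ r → B ∈ₗ level r) (sym A≡B) (∈-level⁺ idB)
       | subst (λ r → C ∈ₗ level r) (sym A≡C) (∈-level⁺ idC)
       | two ∣ A ∣ (∣p∣≤n A)
  ... | _ ∷ []     | here refl | here refl | _ | _ = A≢B refl
  ... | _ ∷ _ ∷ [] | here refl | here refl | _ | _ = A≢B refl
  ... | _ ∷ _ ∷ [] | here refl | there (here refl) | here refl | _ = A≢C refl
  ... | _ ∷ _ ∷ [] | here refl | there (here refl) | there (here refl) | _ = B≢C refl
  ... | _ ∷ _ ∷ [] | there (here refl) | there (here refl) | _ | _ = A≢B refl
  ... | _ ∷ _ ∷ [] | there (here refl) | here refl | here refl | _ = B≢C refl
  ... | _ ∷ _ ∷ [] | there (here refl) | here refl | there (here refl) | _ = A≢C refl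
  ... | _ ∷ _ ∷ _ ∷ _ | _ | _ | _ | s≤s (s≤s ())

  noThree⇒atMostTwo : NoThree → AtMostTwoPerRank Q
  noThree⇒atMostTwo none r _ = go (level r) (level-unique r) ∈-level⁻
    where
    go : ∀ Is → Unique Is → (∀ {I} → I ∈ₗ Is → IsIdeal Q I × ∣ I ∣ ≡ r) → length Is ≤ 2
    go []           _ _ = z≤n
    go (_ ∷ [])     _ _ = s≤s z≤n
    go (_ ∷ _ ∷ []) _ _ = s≤s (s≤s z≤n)
    go (A ∷ B ∷ C ∷ _) ((A≢B ∷ A≢C ∷ _) ∷ (B≢C ∷ _) ∷ _) f
      with f (here refl) | f (there (here refl)) | f (there (there (here refl)))
    ... | idA , A≡r | idB , B≡r | idC , C≡r =
      ⊥-elim (none idA idB idC (trans A≡r (sym B≡r)) (trans A≡r (sym C≡r)) A≢B A≢C B≢C)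

  module _ (none : NoThree) where

    -- With Z = X ∩ Y, climbing two steps from Z inside X, two steps inside Y, and one step in each
    -- gives three ideals of size |Z| + 2.
    no-2-2-differences : ∀ {X Y} → IsIdeal Q X → IsIdeal Q Y →
      2 + ∣ X ∩ Y ∣ ≤ ∣ X ∣ → 2 + ∣ X ∩ Y ∣ ≤ ∣ Y ∣ → ⊥
    no-2-2-differences {X} {Y} idX idY Z+2≤X Z+2≤Y =
      let Z = X ∩ Y
          idZ = ∩-ideal idX idY
          X₁ , idX₁ , X₁≡ , Z⊆X₁ , X₁⊆X = between-suc idZ idX (p∩q⊆p X Y) (ℕₚ.<⇒≤ Z+2≤X)
          Y₁ , idY₁ , Y₁≡ , Z⊆Y₁ , Y₁⊆Y = between-suc idZ idY (p∩q⊆q X Y) (ℕₚ.<⇒≤ Z+2≤Y)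
          X₂ , idX₂ , X₂≡ , X₁⊆X₂ , X₂⊆X =
            between idX₁ idX X₁⊆X (ℕₚ.≤-trans (ℕₚ.≤-reflexive X₁≡) (ℕₚ.n≤1+n _)) Z+2≤X
          Y₂ , idY₂ , Y₂≡ , Y₁⊆Y₂ , Y₂⊆Y =
            between idY₁ idY Y₁⊆Y (ℕₚ.≤-trans (ℕₚ.≤-reflexive Y₁≡) (ℕₚ.n≤1+n _)) Z+2≤Y
          x , x∈X₁ , x∉Z = ∣p∣<∣q∣⇒∃ {p = Z} {X₁} (ℕₚ.≤-reflexive (sym X₁≡))
          y , y∈Y₁ , y∉Z = ∣p∣<∣q∣⇒∃ {p = Z} {Y₁} (ℕₚ.≤-reflexive (sym Y₁≡))
          x∉Y = λ x∈Y → x∉Z (x∈p∩q⁺ (X₁⊆X x∈X₁ , x∈Y))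
          y∉X = λ y∈X → y∉Z (x∈p∩q⁺ (y∈X , Y₁⊆Y y∈Y₁))
          X₁<∪ = p⊂q⇒∣p∣<∣q∣ {p = X₁} {X₁ ∪ Y₁}
            (p⊆p∪q Y₁ , y , q⊆p∪q X₁ Y₁ y∈Y₁ , λ y∈X₁ → y∉X (X₁⊆X y∈X₁))
          W , idW , W≡ , X₁⊆W , W⊆∪ = between-suc idX₁ (∪-ideal idX₁ idY₁) (p⊆p∪q Y₁) X₁<∪
          w , w∈W , w∉X₁ = ∣p∣<∣q∣⇒∃ {p = X₁} {W} (ℕₚ.≤-reflexive (sym W≡))
          w∈Y₁ = right (x∈p∪q⁻ X₁ Y₁ (W⊆∪ w∈W)) w∉X₁
          w∉X = λ w∈X → w∉X₁ (Z⊆X₁ (x∈p∩q⁺ (w∈X , Y₁⊆Y w∈Y₁)))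
      in none idX₂ idY₂ idW (trans X₂≡ (sym Y₂≡)) (trans X₂≡ (sym (trans W≡ (cong suc X₁≡))))
        (λ X₂≡Y₂ → x∉Y (Y₂⊆Y (subst (x ∈_) X₂≡Y₂ (X₁⊆X₂ x∈X₁))))
        (λ X₂≡W → w∉X (X₂⊆X (subst (w ∈_) (sym X₂≡W) w∈W)))
        (λ Y₂≡W → x∉Y (Y₂⊆Y (subst (x ∈_) (sym Y₂≡W) (X₁⊆W x∈X₁))))
      where
      right : {A B : Set} → A ⊎ B → ¬ A → B
      right (inj₁ a) ¬a = contradiction a ¬a
      right (inj₂ b) _  = b

    noThree⇒forbiddenFree : ForbiddenFree Q
    noThree⇒forbiddenFree = no22 , no111
      where
      no22 : TwoPlusTwoFree Q
      no22 (a , b , c , d , (a≤b , a≢b) , (c≤d , c≢d) , (a≰c , c≰a) , (a≰d , d≰a) , (b≰c , c≰b) , (b≰d , d≰b)) =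
        no-2-2-differences (↓-ideal b) (↓-ideal d)
          (2+∣p∣≤∣q∣ (p∩q⊆p (↓ b) (↓ d)) a≢b (∈-tabulate⁺ _ a≤b) (a≰d ∘ belowd) (∈-tabulate⁺ _ (≤-refl b)) (b≰d ∘ belowd))
          (2+∣p∣≤∣q∣ (p∩q⊆q (↓ b) (↓ d)) c≢d (∈-tabulate⁺ _ c≤d) (c≰b ∘ belowb) (∈-tabulate⁺ _ (≤-refl d)) (d≰b ∘ belowb))
        where
        belowb : ∀ {x} → x ∈ (↓ b) ∩ (↓ d) → T (le Q x b)
        belowb x∈ = ∈-tabulate⁻ _ (p∩q⊆p (↓ b) (↓ d) x∈)
        belowd : ∀ {x} → x ∈ (↓ b) ∩ (↓ d) → T (le Q x d)
        belowd x∈ = ∈-tabulate⁻ _ (p∩q⊆q (↓ b) (↓ d) x∈)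

      -- Let `D` consist of the elements strictly below `a`, `b` or `c`. An antichain is disjoint
      -- from `D`, so adjoining `a`, `b` or `c` to `D` gives three distinct ideals of the same size.
      no111 : OnePlusOnePlusOneFree Q
      no111 (a , b , c , (a≰b , b≰a) , (a≰c , c≰a) , (b≰c , c≰b)) =
        none (D+-ideal a (λ { x≤a x≢a → inj₁ (x≤a , x≢a) }))
             (D+-ideal b (λ { x≤b x≢b → inj₂ (inj₁ (x≤b , x≢b)) }))
             (D+-ideal c (λ { x≤c x≢c → inj₂ (inj₂ (x≤c , x≢c)) }))
             (trans (∣p∪⁅x⁆∣≡1+∣p∣ D a a∉D) (sym (∣p∪⁅x⁆∣≡1+∣p∣ D b b∉D)))
             (trans (∣p∪⁅x⁆∣≡1+∣p∣ D a a∉D) (sym (∣p∪⁅x⁆∣≡1+∣p∣ D c c∉D)))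
             (distinct a∉D λ { refl → a≰b (≤-refl a) })
             (distinct a∉D λ { refl → a≰c (≤-refl a) })
             (distinct b∉D λ { refl → b≰c (≤-refl b) })
        where
        Below : Fin n → Set
        Below x = x <[ Q ] a ⊎ x <[ Q ] b ⊎ x <[ Q ] c
        below? : ∀ x → Dec (Below x)
        below? x = lt? a ⊎-dec (lt? b ⊎-dec lt? c)
          where
          lt? : ∀ y → Dec (x <[ Q ] y)
          lt? y = T? (le Q x y) ×-dec ¬? (x Finₚ.≟ y)
        D : Subset n
        D = tabulate (λ x → ⌊ below? x ⌋)
        ∈D⁻ : ∀ {x} → x ∈ D → Below x
        ∈D⁻ {x} x∈ = toWitness {a? = below? x} (∈-tabulate⁻ _ x∈)
        ∈D⁺ : ∀ {x} → Below x → x ∈ D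
        ∈D⁺ {x} x∈ = ∈-tabulate⁺ _ (fromWitness {a? = below? x} x∈)
        lt : ∀ {x y z} → T (le Q x y) → y <[ Q ] z → x <[ Q ] z
        lt {x} {y} {z} x≤y (y≤z , y≢z) = ≤-trans x y z x≤y y≤z , λ { refl → y≢z (≤-antisym y z y≤z x≤y) }
        D-ideal : IsIdeal Q D
        D-ideal x≤y y∈ with ∈D⁻ y∈
        ... | inj₁ y<a = ∈D⁺ (inj₁ (lt x≤y y<a))
        ... | inj₂ (inj₁ y<b) = ∈D⁺ (inj₂ (inj₁ (lt x≤y y<b)))
        ... | inj₂ (inj₂ y<c) = ∈D⁺ (inj₂ (inj₂ (lt x≤y y<c)))
        D+-ideal : ∀ v → (∀ {x} → T (le Q x v) → x ≢ v → Below x) → IsIdeal Q (D ∪ ⁅ v ⁆)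
        D+-ideal v f {x} {y} x≤y y∈ with x∈p∪q⁻ D ⁅ v ⁆ y∈
        ... | inj₁ y∈D = x∈p∪q⁺ (inj₁ (D-ideal x≤y y∈D))
        ... | inj₂ y∈v with x∈⁅y⁆⇒x≡y v y∈v | x Finₚ.≟ v
        ... | refl | yes refl = x∈p∪q⁺ (inj₂ (x∈⁅x⁆ v))
        ... | refl | no x≢v   = x∈p∪q⁺ (inj₁ (∈D⁺ (f x≤y x≢v)))
        a∉D : a ∉ D
        a∉D a∈ with ∈D⁻ a∈
        ... | inj₁ (_ , a≢a) = a≢a refl
        ... | inj₂ (inj₁ (a≤b , _)) = a≰b a≤b
        ... | inj₂ (inj₂ (a≤c , _)) = a≰c a≤c
        b∉D : b ∉ D
        b∉D b∈ with ∈D⁻ b∈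
        ... | inj₁ (b≤a , _) = b≰a b≤a
        ... | inj₂ (inj₁ (_ , b≢b)) = b≢b refl
        ... | inj₂ (inj₂ (b≤c , _)) = b≰c b≤c
        c∉D : c ∉ D
        c∉D c∈ with ∈D⁻ c∈
        ... | inj₁ (c≤a , _) = c≰a c≤a
        ... | inj₂ (inj₁ (c≤b , _)) = c≰b c≤b
        ... | inj₂ (inj₂ (_ , c≢c)) = c≢c refl
        distinct : ∀ {u v} → u ∉ D → u ≢ v → D ∪ ⁅ u ⁆ ≢ D ∪ ⁅ v ⁆
        distinct {u} {v} u∉D u≢v eq with x∈p∪q⁻ D ⁅ v ⁆ (subst (u ∈_) eq (x∈p∪q⁺ (inj₂ (x∈⁅x⁆ u))))
        ... | inj₁ u∈D = u∉D u∈D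
        ... | inj₂ u∈v = u≢v (x∈⁅y⁆⇒x≡y v u∈v)

  module _ (free : ForbiddenFree Q) where

    private
      crossing : ∀ {X Y a b} → IsIdeal Q X → IsIdeal Q Y → a ∈ X → a ∉ Y → b ∈ Y → b ∉ X → Incomparable Q a b
      crossing idX idY a∈X a∉Y b∈Y b∉X = (λ a≤b → a∉Y (idY a≤b b∈Y)) , (λ b≤a → b∉X (idX b≤a a∈X))

      swap : ∀ {a b} → Incomparable Q a b → Incomparable Q b a
      swap (p , q) = q , p

      comparable : ∀ {a b c} → Incomparable Q a c → Incomparable Q b c → T (le Q a b) ⊎ T (le Q b a)
      comparable {a} {b} {c} a∥c b∥c with T? (le Q a b) | T? (le Q b a)
      ... | yes a≤b | _       = inj₁ a≤b
      ... | no _    | yes b≤a = inj₂ b≤a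
      ... | no a≰b  | no b≰a  = contradiction (a , b , c , (a≰b , b≰a) , a∥c , b∥c) (proj₂ free)

      -- All four cross pairs are incomparable. Absence of 3-antichains then makes `a`, `a'`
      -- comparable and `b`, `b'` comparable, which is a 2+2; the four cases only settle the
      -- direction of each chain.
      not-2-2 : ∀ {X Y a a' b b'} → IsIdeal Q X → IsIdeal Q Y → a ≢ a' → b ≢ b' →
        a ∈ X → a ∉ Y → a' ∈ X → a' ∉ Y → b ∈ Y → b ∉ X → b' ∈ Y → b' ∉ X → ⊥
      not-2-2 {X} {Y} {a} {a'} {b} {b'} idX idY a≢a' b≢b' a∈X a∉Y a'∈X a'∉Y b∈Y b∉X b'∈Y b'∉X =
        case (comparable ab a'b) (comparable (swap ab) (swap ab'))
        where
        ab   = crossing idX idY a∈X a∉Y b∈Y b∉X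
        ab'  = crossing idX idY a∈X a∉Y b'∈Y b'∉X
        a'b  = crossing idX idY a'∈X a'∉Y b∈Y b∉X
        a'b' = crossing idX idY a'∈X a'∉Y b'∈Y b'∉X
        case : T (le Q a a') ⊎ T (le Q a' a) → T (le Q b b') ⊎ T (le Q b' b) → ⊥
        case (inj₁ p) (inj₁ q) = proj₁ free (a , a' , b , b' , (p , a≢a') , (q , b≢b') , ab , ab' , a'b , a'b')
        case (inj₁ p) (inj₂ q) = proj₁ free (a , a' , b' , b , (p , a≢a') , (q , ≢-sym b≢b') , ab' , ab , a'b' , a'b)
        case (inj₂ p) (inj₁ q) = proj₁ free (a' , a , b , b' , (p , ≢-sym a≢a') , (q , b≢b') , a'b , a'b' , ab , ab')
        case (inj₂ p) (inj₂ q) = proj₁ free (a' , a , b' , b , (p , ≢-sym a≢a') , (q , ≢-sym b≢b') , a'b' , a'b , ab' , ab)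

      differ : ∀ {X Y : Subset n} → ∣ X ∣ ≡ ∣ Y ∣ → X ≢ Y → ∃[ x ] (x ∈ X × x ∉ Y)
      differ X≡Y X≢Y = ⊈⇒∃ λ X⊆Y → X≢Y (⊆∧∣q∣≤∣p∣⇒≡ X⊆Y (ℕₚ.≤-reflexive (sym X≡Y)))

      two-private : ∀ (X Y : Subset n) → 2 + ∣ X ∩ Y ∣ ≤ ∣ Y ∣ →
        ∃[ b ] ∃[ b' ] (b ≢ b' × b ∈ Y × b ∉ X × b' ∈ Y × b' ∉ X)
      two-private X Y X∩Y+2≤Y =
        let b , b∈Y , b∉X∩Y = ∣p∣<∣q∣⇒∃ {p = X ∩ Y} {Y} (ℕₚ.<⇒≤ X∩Y+2≤Y)
            b' , b'∈Y , b'∉ = ∣p∣<∣q∣⇒∃ {p = (X ∩ Y) ∪ ⁅ b ⁆} {Y}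
              (subst (_≤ ∣ Y ∣) (cong suc (sym (∣p∪⁅x⁆∣≡1+∣p∣ (X ∩ Y) b b∉X∩Y))) X∩Y+2≤Y)
        in b , b' , (λ b≡b' → b'∉ (x∈p∪q⁺ (inj₂ (subst (_∈ ⁅ b ⁆) b≡b' (x∈⁅x⁆ b))))) ,
           b∈Y , (λ b∈X → b∉X∩Y (x∈p∩q⁺ (b∈X , b∈Y))) ,
           b'∈Y , (λ b'∈X → b'∉ (x∈p∪q⁺ (inj₁ (x∈p∩q⁺ (b'∈X , b'∈Y)))))

      -- As the sizes agree, two elements of `X` outside `Y` would be matched by two elements of `Y`
      -- outside `X`, against `not-2-2`.
      private-equal : ∀ {X Y a a'} → IsIdeal Q X → IsIdeal Q Y → ∣ X ∣ ≡ ∣ Y ∣ →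
        a ∈ X → a ∉ Y → a' ∈ X → a' ∉ Y → a ≡ a'
      private-equal {X} {Y} {a} {a'} idX idY X≡Y a∈X a∉Y a'∈X a'∉Y = decidable-stable (a Finₚ.≟ a') λ a≢a' →
        let b , b' , b≢b' , b∈Y , b∉X , b'∈Y , b'∉X = two-private X Y (subst (2 + ∣ X ∩ Y ∣ ≤_) X≡Y
              (2+∣p∣≤∣q∣ (p∩q⊆p X Y) a≢a' a∈X (a∉Y ∘ p∩q⊆q X Y) a'∈X (a'∉Y ∘ p∩q⊆q X Y)))
        in not-2-2 idX idY a≢a' b≢b' a∈X a∉Y a'∈X a'∉Y b∈Y b∉X b'∈Y b'∉X

    -- By `private-equal`, `X` and `Y` differ by exchanging `a` for `b`. If `Z` contains both, then
    -- an element `d` of `X` missing from `Z` lies in `Y` too, and `a`, `b`, `d` form an antichain.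
    -- If `Z` contains neither, then an element `c` of `Z` outside `X` is outside `Y` as well, and
    -- `a`, `b`, `c` form an antichain. If `Z` contains just one of them, then `Z` has two elements
    -- outside `Y` or two outside `X`, against `private-equal`.
    forbiddenFree⇒noThree : NoThree
    forbiddenFree⇒noThree {X} {Y} {Z} idX idY idZ X≡Y X≡Z X≢Y X≢Z Y≢Z
      with differ X≡Y X≢Y | differ (sym X≡Y) (≢-sym X≢Y)
         | differ X≡Z X≢Z | differ (sym X≡Z) (≢-sym X≢Z)
    ... | a , a∈X , a∉Y | b , b∈Y , b∉X | d , d∈X , d∉Z | c , c∈Z , c∉X
      with a ∈? Z | b ∈? Z
    ... | yes a∈Z | yes b∈Z = proj₂ free (a , b , d , crossing idX idY a∈X a∉Y b∈Y b∉X ,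
          crossing idZ idY a∈Z a∉Y d∈Y d∉Z , crossing idZ idX b∈Z b∉X d∈X d∉Z)
      where
      d∈Y : d ∈ Y
      d∈Y = decidable-stable (d ∈? Y) λ d∉Y → d∉Z (subst (_∈ Z) (private-equal idX idY X≡Y a∈X a∉Y d∈X d∉Y) a∈Z)
    ... | no a∉Z | no b∉Z = proj₂ free (a , b , c , crossing idX idY a∈X a∉Y b∈Y b∉X ,
          crossing idX idZ a∈X a∉Z c∈Z c∉X , crossing idY idZ b∈Y b∉Z c∈Z c∉Y)
      where
      c∉Y : c ∉ Y
      c∉Y c∈Y = b∉Z (subst (_∈ Z) (private-equal idY idX (sym X≡Y) c∈Y c∉X b∈Y b∉X) c∈Z)
    ... | yes a∈Z | no b∉Z = c∉X (subst (_∈ X) (private-equal idZ idY (trans (sym X≡Z) X≡Y) a∈Z a∉Y c∈Z c∉Y) a∈X)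
      where
      c∉Y : c ∉ Y
      c∉Y c∈Y = b∉Z (subst (_∈ Z) (private-equal idY idX (sym X≡Y) c∈Y c∉X b∈Y b∉X) c∈Z)
    ... | no a∉Z | yes b∈Z with differ (trans (sym X≡Y) X≡Z) Y≢Z | differ (trans (sym X≡Z) X≡Y) (≢-sym Y≢Z)
    ... | e , e∈Y , e∉Z | f , f∈Z , f∉Y =
      f∉Y (subst (_∈ Y) (private-equal idZ idX (sym X≡Z) b∈Z b∉X f∈Z f∉X) b∈Y)
      where
      f∉X : f ∉ X
      f∉X f∈X = a∉Z (subst (_∈ Z) (private-equal idX idY X≡Y f∈X f∉Y a∈X a∉Y) f∈Z)

  atMostTwo⇔forbiddenFree : AtMostTwoPerRank Q ⇔ ForbiddenFree Q
  atMostTwo⇔forbiddenFree = mk⇔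
    (λ two → noThree⇒forbiddenFree (atMostTwo⇒noThree two))
    (λ free → noThree⇒atMostTwo (forbiddenFree⇒noThree free))

-- The flag h-vector

module _ {P P' : X → Set} (P? : Decidable P) (P'? : Decidable P') where

  filter-⇔ : ∀ {xs} → (∀ {x} → x ∈ₗ xs → P x ⇔ P' x) → filter P? xs ≡ filter P'? xs
  filter-⇔ {[]} _ = refl
  filter-⇔ {x ∷ xs} iff with P? x | P'? x
  ... | yes _ | yes _  = cong (x ∷_) (filter-⇔ (iff ∘ there))
  ... | no _  | no _   = filter-⇔ (iff ∘ there)
  ... | yes p | no ¬p' = contradiction (iff (here refl) .to p) ¬p'
  ... | no ¬p | yes p' = contradiction (iff (here refl) .from p') ¬p

  filter-×-dec : ∀ xs → filter (λ x → P? x ×-dec P'? x) xs ≡ filter P'? (filter P? xs)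
  filter-×-dec [] = refl
  filter-×-dec (x ∷ xs) with P? x
  ... | no _ = filter-×-dec xs
  ... | yes _ with P'? x
  ... | yes _ = cong (x ∷_) (filter-×-dec xs)
  ... | no _  = filter-×-dec xs

filter-map-⇔ : {P : Y → Set} {P' : X → Set} (P? : Decidable P) (P'? : Decidable P') (f : X → Y) →
  (∀ x → P (f x) ⇔ P' x) → ∀ xs → filter P? (map f xs) ≡ map f (filter P'? xs)
filter-map-⇔ P? P'? f iff [] = refl
filter-map-⇔ P? P'? f iff (x ∷ xs) with P? (f x) | P'? x
... | yes _ | yes _  = cong (f x ∷_) (filter-map-⇔ P? P'? f iff xs)
... | no _  | no _   = filter-map-⇔ P? P'? f iff xs
... | yes p | no ¬p' = contradiction (iff x .to p) ¬p'
... | no ¬p | yes p' = contradiction (iff x .from p') ¬p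

unique-constant⇒length≤1 : {c : X} (xs : List X) → Unique xs → (∀ {x} → x ∈ₗ xs → x ≡ c) → length xs ≤ 1
unique-constant⇒length≤1 []       _ _ = z≤n
unique-constant⇒length≤1 (_ ∷ []) _ _ = s≤s z≤n
unique-constant⇒length≤1 (x ∷ y ∷ _) ((x≢y ∷ _) ∷ _) const =
  contradiction (trans (const (here refl)) (sym (const (there (here refl))))) x≢y

-- Alternating sums over the subsets of a set.

sumℤ : List ℤ → ℤ
sumℤ = L.foldr ℤ._+_ (+ 0)

sumℤ-++ : ∀ xs ys → sumℤ (xs ++ ys) ≡ sumℤ xs ℤ.+ sumℤ ys
sumℤ-++ []       ys = sym (ℤₚ.+-identityˡ _)
sumℤ-++ (x ∷ xs) ys = trans (cong (λ s → x ℤ.+ s) (sumℤ-++ xs ys)) (sym (ℤₚ.+-assoc x _ _))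

sumℤ-neg : (f : X → ℤ) → ∀ xs → sumℤ (map (λ x → - f x) xs) ≡ - sumℤ (map f xs)
sumℤ-neg f []       = refl
sumℤ-neg f (x ∷ xs) = trans (cong (λ s → - f x ℤ.+ s) (sumℤ-neg f xs)) (sym (ℤₚ.neg-distrib-+ (f x) _))

sumℤ-pos : (f : X → ℕ) → ∀ xs → + NL.sum (map f xs) ≡ sumℤ (map (λ x → + f x) xs)
sumℤ-pos f []       = refl
sumℤ-pos f (x ∷ xs) = cong (λ s → + f x ℤ.+ s) (sumℤ-pos f xs)

sumℤ-ones : (xs : List X) → sumℤ (map (λ _ → + 1) xs) ≡ + length xs
sumℤ-ones []       = refl
sumℤ-ones (x ∷ xs) = cong (λ s → + 1 ℤ.+ s) (sumℤ-ones xs)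

-- The inclusion-exclusion sum of `φ` over the subsets of `S`, written as an iterated difference
-- with one difference for each element of `S`. In this form linearity and the recursion for `flagh`
-- follow coordinate by coordinate.
Δ : Subset m → (Subset m → ℤ) → ℤ
Δ []          φ = φ []
Δ (false ∷ S) φ = Δ S (φ ∘ (false ∷_))
Δ (true ∷ S)  φ = Δ S (φ ∘ (true ∷_)) ℤ.- Δ S (φ ∘ (false ∷_))

Δ-cong : (S : Subset m) {φ ψ : Subset m → ℤ} → (∀ T → φ T ≡ ψ T) → Δ S φ ≡ Δ S ψ
Δ-cong []          eq = eq []
Δ-cong (false ∷ S) eq = Δ-cong S (eq ∘ (false ∷_))
Δ-cong (true ∷ S)  eq = cong₂ ℤ._-_ (Δ-cong S (eq ∘ (true ∷_))) (Δ-cong S (eq ∘ (false ∷_)))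

interchange : ∀ a b c d → (a ℤ.+ b) ℤ.- (c ℤ.+ d) ≡ (a ℤ.- c) ℤ.+ (b ℤ.- d)
interchange = ℤ-Solver.solve-∀

Δ-zero : (S : Subset m) → Δ S (λ _ → + 0) ≡ + 0
Δ-zero []          = refl
Δ-zero (false ∷ S) = Δ-zero S
Δ-zero (true ∷ S)  = cong₂ ℤ._-_ (Δ-zero S) (Δ-zero S)

Δ-+ : (S : Subset m) (φ ψ : Subset m → ℤ) → Δ S (λ T → φ T ℤ.+ ψ T) ≡ Δ S φ ℤ.+ Δ S ψ
Δ-+ []          φ ψ = refl
Δ-+ (false ∷ S) φ ψ = Δ-+ S _ _
Δ-+ (true ∷ S)  φ ψ = trans (cong₂ ℤ._-_ (Δ-+ S _ _) (Δ-+ S _ _)) (interchange (Δ S (φ ∘ (true ∷_))) _ _ _)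

Δ-sum : (S : Subset m) (φ : X → Subset m → ℤ) → ∀ xs →
  Δ S (λ T → sumℤ (map (λ x → φ x T) xs)) ≡ sumℤ (map (λ x → Δ S (φ x)) xs)
Δ-sum S φ []       = Δ-zero S
Δ-sum S φ (x ∷ xs) = trans (Δ-+ S (φ x) _) (cong (λ s → Δ S (φ x) ℤ.+ s) (Δ-sum S φ xs))

-- Split the subsets by their first coordinate. If `S` lacks the first element, the filter discards
-- every subset containing it; otherwise omitting that element enlarges the difference `S ─ T` by
-- one and so flips the sign.
alternatingSum≡Δ : (S : Subset m) (φ : Subset m → ℤ) →
  sumℤ (map (λ T → signPow ∣ S ─ T ∣ ℤ.* φ T) (filter (_⊆? S) (allSubsets m))) ≡ Δ S φ
alternatingSum≡Δ [] φ = trans (ℤₚ.+-identityʳ _) (ℤₚ.*-identityˡ _)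
alternatingSum≡Δ {suc m} (s ∷ S) φ = begin
  sumℤ (map g (filter (_⊆? (s ∷ S)) (map (false ∷_) (allSubsets m) ++ map (true ∷_) (allSubsets m))))
    ≡⟨ cong (sumℤ ∘ map g) (filter-++ (_⊆? (s ∷ S)) (map (false ∷_) (allSubsets m)) _) ⟩
  sumℤ (map g (first ++ rest))
    ≡⟨ cong sumℤ (map-++ g first rest) ⟩
  sumℤ (map g first ++ map g rest)
    ≡⟨ sumℤ-++ (map g first) (map g rest) ⟩
  sumℤ (map g first) ℤ.+ sumℤ (map g rest)
    ≡⟨ cong (λ l → sumℤ (map g l) ℤ.+ sumℤ (map g rest))
         (filter-map-⇔ _ (_⊆? S) (false ∷_) (λ _ → ⇔-sym out⊆-⇔) (allSubsets m)) ⟩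
  sumℤ (map g (map (false ∷_) below)) ℤ.+ sumℤ (map g rest)
    ≡⟨ cong (λ l → sumℤ l ℤ.+ sumℤ (map g rest)) (sym (map-∘ below)) ⟩
  sumℤ (map (g ∘ (false ∷_)) below) ℤ.+ sumℤ (map g rest)
    ≡⟨ last s refl ⟩
  Δ (s ∷ S) φ ∎
  where
  open ≡-Reasoning
  g : Subset (suc m) → ℤ
  g T = signPow ∣ (s ∷ S) ─ T ∣ ℤ.* φ T
  below : List (Subset m)
  below = filter (_⊆? S) (allSubsets m)
  first rest : List (Subset (suc m))
  first = filter (_⊆? (s ∷ S)) (map (false ∷_) (allSubsets m))
  rest = filter (_⊆? (s ∷ S)) (map (true ∷_) (allSubsets m))
  last : ∀ s' → s' ≡ s → sumℤ (map (g ∘ (false ∷_)) below) ℤ.+ sumℤ (map g rest) ≡ Δ (s' ∷ S) φ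
  last false refl = trans
    (cong (λ l → sumℤ (map (g ∘ (false ∷_)) below) ℤ.+ sumℤ (map g l))
      (filter-none (_⊆? (false ∷ S)) {map (true ∷_) (allSubsets m)} (Allₚ.map⁺ (All.tabulate λ _ q → contradiction (q here) λ ()))))
    (trans (ℤₚ.+-identityʳ _) (alternatingSum≡Δ S (φ ∘ (false ∷_))))
  last true refl = trans (ℤₚ.+-comm (sumℤ (map (g ∘ (false ∷_)) below)) _) (cong₂ ℤ._+_
    (trans (cong (sumℤ ∘ map g) (filter-map-⇔ _ (_⊆? S) (true ∷_) (λ _ → ⇔-sym in⊆in-⇔) (allSubsets m)))
      (trans (cong sumℤ (sym (map-∘ below))) (alternatingSum≡Δ S (φ ∘ (true ∷_)))))
    (trans (cong sumℤ (map-cong (λ T → sym (ℤₚ.neg-distribˡ-* (signPow ∣ S ─ T ∣) (φ (false ∷ T)))) below))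
      (trans (sumℤ-neg _ below) (cong -_ (alternatingSum≡Δ S (φ ∘ (false ∷_)))))))

-- `rankList` as a recursion on the vector. The offset `o` counts the coordinates already passed, so
-- position `i` stands for rank `o + i + 1`.
ranks : ℕ → Subset m → List ℕ
ranks o []          = []
ranks o (false ∷ S) = ranks (suc o) S
ranks o (true ∷ S)  = suc o ∷ ranks (suc o) S

map-filter-tabulate≡ranks : (S : Subset m) (o : ℕ) (g : Fin m → X) {P : X → Set} (P? : Decidable P) (f : X → ℕ) →
  (∀ i → P (g i) ⇔ i ∈ S) → (∀ i → f (g i) ≡ suc (o + toℕ i)) →
  map f (filter P? (L.tabulate g)) ≡ ranks o S
map-filter-tabulate≡ranks []      o g P? f iff eq = refl
map-filter-tabulate≡ranks (s ∷ S) o g P? f iff eq = head s (iff zero)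
  where
  tail : map f (filter P? (L.tabulate (g ∘ suc))) ≡ ranks (suc o) S
  tail = map-filter-tabulate≡ranks S (suc o) (g ∘ suc) P? f
    (λ i → mk⇔ (drop-there ∘ iff (suc i) .to) (iff (suc i) .from ∘ there))
    (λ i → trans (eq (suc i)) (cong suc (ℕₚ.+-suc o (toℕ i))))
  head : ∀ s → _ ⇔ (zero ∈ s ∷ S) → map f (filter P? (g zero ∷ L.tabulate (g ∘ suc))) ≡ ranks o (s ∷ S)
  head s iff₀ with P? (g zero)
  head true  iff₀ | yes _ = cong₂ _∷_ (trans (eq zero) (cong suc (ℕₚ.+-identityʳ o))) tail
  head false iff₀ | yes p = contradiction (iff₀ .to p) λ ()
  head true  iff₀ | no ¬p = contradiction (iff₀ .from here) ¬p
  head false iff₀ | no _  = tail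

rankList≡ranks : (S : Subset m) → rankList S ≡ ranks 0 S
rankList≡ranks S = map-filter-tabulate≡ranks S 0 id (_∈? S) _ (λ _ → mk⇔ id id) (λ _ → refl)

ranks-∅ : ∀ m o → ranks o (∅ {m}) ≡ []
ranks-∅ zero    o = refl
ranks-∅ (suc m) o = ranks-∅ m (suc o)

ranks-⁅⁆ : ∀ o (i : Fin m) → ranks o ⁅ i ⁆ ≡ suc (o + toℕ i) ∷ []
ranks-⁅⁆ {suc m} o zero    = cong₂ _∷_ (cong suc (sym (ℕₚ.+-identityʳ o))) (ranks-∅ m (suc o))
ranks-⁅⁆         o (suc i) = trans (ranks-⁅⁆ (suc o) i) (cong (λ k → suc k ∷ []) (sym (ℕₚ.+-suc o (toℕ i))))

data Ascending (N : ℕ) : ℕ → List ℕ → Set where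
  []  : ∀ {o} → Ascending N o []
  _∷_ : ∀ {o r rs} → (o < r × r ≤ N) → Ascending N r rs → Ascending N o (r ∷ rs)

weaken : ∀ {N o o' rs} → o ≤ o' → Ascending N o' rs → Ascending N o rs
weaken o≤o' []                 = []
weaken o≤o' ((o'<r , r≤N) ∷ a) = (ℕₚ.≤-<-trans o≤o' o'<r , r≤N) ∷ a

ranks-ascending : (S : Subset m) (o N : ℕ) → o + m ≤ N → Ascending N o (ranks o S)
ranks-ascending []          o N le = []
ranks-ascending {suc m} (false ∷ S) o N le =
  weaken (ℕₚ.n≤1+n o) (ranks-ascending S (suc o) N (subst (_≤ N) (ℕₚ.+-suc o m) le))
ranks-ascending {suc m} (true ∷ S)  o N le = (ℕₚ.n<1+n o , ℕₚ.m+n≤o⇒m≤o (suc o) le') ∷ ranks-ascending S (suc o) N le'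
  where le' = subst (_≤ N) (ℕₚ.+-suc o m) le

NonConsecutive : List ℕ → Set
NonConsecutive = Linked (λ r r' → r' ≢ suc r)

nonConsecutive⇒sparse : (S : Subset m) (o : ℕ) → NonConsecutive (ranks o S) → Sparse S
nonConsecutive⇒sparse (true ∷ true ∷ S) o (r≢ ∷ _) zero (suc zero) _ _ _ = r≢ refl
nonConsecutive⇒sparse (false ∷ _) o l zero (suc zero) _ () _
nonConsecutive⇒sparse (true ∷ false ∷ _) o l zero (suc zero) _ _ (there ())
nonConsecutive⇒sparse (true ∷ S) o l (suc i) (suc j) eq (there i∈) (there j∈) =
  nonConsecutive⇒sparse S (suc o) (Linked.tail l) i j (ℕₚ.suc-injective eq) i∈ j∈
nonConsecutive⇒sparse (false ∷ S) o l (suc i) (suc j) eq (there i∈) (there j∈) =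
  nonConsecutive⇒sparse S (suc o) l i j (ℕₚ.suc-injective eq) i∈ j∈

module _ (Q : Poset n) where

  seen : ℕ → Subset n → List (Subset n)
  seen r J = filter (J ⊆?_) (level Q r)

  flagh : List ℕ → Subset n → ℤ
  flagh []       J = + 1
  flagh (r ∷ rs) J = sumℤ (map (flagh rs) (seen r J)) ℤ.- flagh rs J

  -- For a rank `r` in `S`, the sets `T` that contain `r` count chains whose first member is an
  -- ideal of rank `r` containing `J`, while the other sets `T` count chains that still start above
  -- `J`. Linearity carries `Δ` past the sum over that first member.
  Δ-countChains : (S : Subset m) (o : ℕ) (J : Subset n) →
    Δ S (λ T → + countChains Q (ranks o T) J) ≡ flagh (ranks o S) J
  Δ-countChains []          o J = refl
  Δ-countChains (false ∷ S) o J = Δ-countChains S (suc o) J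
  Δ-countChains (true ∷ S)  o J = cong₂ ℤ._-_
    (trans (Δ-cong S λ T →
        trans (cong (λ l → + NL.sum (map (countChains Q (ranks (suc o) T)) l)) (filter-×-dec _ (J ⊆?_) (orderIdeals Q)))
              (sumℤ-pos (countChains Q (ranks (suc o) T)) (seen (suc o) J)))
      (trans (Δ-sum S (λ I T → + countChains Q (ranks (suc o) T) I) (seen (suc o) J))
        (cong sumℤ (map-cong (Δ-countChains S (suc o)) (seen (suc o) J)))))
    (Δ-countChains S (suc o) J)

  flagH≡flagh : (S : Subset (n ∸ 1)) → flagH Q S ≡ flagh (ranks 0 S) ∅
  flagH≡flagh S = trans (alternatingSum≡Δ S (λ T → + flagF Q T))
    (trans (Δ-cong S (λ T → cong (λ rs → + countChains Q rs ∅) (rankList≡ranks T))) (Δ-countChains S 0 ∅))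

  ∈-seen⁺ : ∀ {I J r} → IsIdeal Q I → ∣ I ∣ ≡ r → J ⊆ I → I ∈ₗ seen r J
  ∈-seen⁺ idI refl J⊆I = Memₚ.∈-filter⁺ (_ ⊆?_) (∈-level⁺ Q idI) J⊆I

  ∈-seen⁻ : ∀ {I J r} → I ∈ₗ seen r J → IsIdeal Q I × ∣ I ∣ ≡ r × J ⊆ I
  ∈-seen⁻ {I} {J} {r} I∈ with Memₚ.∈-filter⁻ (J ⊆?_) {xs = level Q r} I∈
  ... | I∈level , J⊆I with ∈-level⁻ Q I∈level
  ... | idI , I≡r = (λ {x} {y} → idI {x} {y}) , I≡r , J⊆I

  between-∅ : ∀ {K r} → IsIdeal Q K → r ≤ ∣ K ∣ → Between Q ∅ r K
  between-∅ {K} {r} idK r≤K = between Q (∅-ideal Q) idK ⊥⊆ (subst (_≤ r) (sym (∣⊥∣≡0 n)) z≤n) r≤K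

  between-full : ∀ {J r} → IsIdeal Q J → ∣ J ∣ ≤ r → r ≤ n → Between Q J r full
  between-full {J} {r} idJ J≤r r≤n = between Q idJ (full-ideal Q) ⊆⊤ J≤r (subst (r ≤_) (sym (∣⊤∣≡n n)) r≤n)

  -- The argument `J` enters `flagh` only through inclusion tests against ideals whose ranks are
  -- listed, and all of these exceed `o`.
  flagh-cong : ∀ {rs o J J'} → Ascending n o rs →
    (∀ {K} → IsIdeal Q K → o < ∣ K ∣ → (J ⊆ K) ⇔ (J' ⊆ K)) → flagh rs J ≡ flagh rs J'
  flagh-cong [] iff = refl
  flagh-cong {r ∷ rs} {o} {J} {J'} ((o<r , _) ∷ a) iff = cong₂ ℤ._-_
    (cong (sumℤ ∘ map (flagh rs)) (filter-⇔ (J ⊆?_) (J' ⊆?_) λ I∈ →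
      let idI , I≡r = ∈-level⁻ Q I∈ in iff idI (subst (o <_) (sym I≡r) o<r)))
    (flagh-cong {J = J} {J'} a λ idK r<K → iff idK (ℕₚ.<-trans o<r r<K))

  -- I and J lie below the same ideals of rank greater than r, so the two terms of the recursion cancel.
  flagh-single : ∀ {r rs I J} → IsIdeal Q J → ∣ J ∣ ≤ r → Ascending n r rs →
    seen r J ≡ I ∷ [] → flagh (r ∷ rs) J ≡ + 0
  flagh-single {r} {rs} {I} {J} idJ J≤r a eq =
    trans (cong (λ l → sumℤ (map (flagh rs) l) ℤ.- flagh rs J) eq)
      (trans (cong (ℤ._- flagh rs J) (trans (ℤₚ.+-identityʳ (flagh rs I)) same)) (ℤₚ.+-inverseʳ (flagh rs J)))
    where
    J⊆I : J ⊆ I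
    J⊆I = proj₂ (proj₂ (∈-seen⁻ {r = r} (subst (I ∈ₗ_) (sym eq) (here refl))))
    I⊆ : ∀ {K} → IsIdeal Q K → r < ∣ K ∣ → J ⊆ K → I ⊆ K
    I⊆ {K} idK r<K J⊆K with between Q {J} {K} idJ idK J⊆K J≤r (ℕₚ.<⇒≤ r<K)
    ... | I' , idI' , I'≡ , J⊆I' , I'⊆K with subst (I' ∈ₗ_) eq (∈-seen⁺ idI' I'≡ J⊆I')
    ... | here refl = I'⊆K
    same : flagh rs I ≡ flagh rs J
    same = flagh-cong {J = I} {J} a λ {K} idK r<K →
      mk⇔ {A = I ⊆ K} {B = J ⊆ K} (λ I⊆K x∈ → I⊆K (J⊆I x∈)) (I⊆ idK r<K)

  seen-nonempty : ∀ {r J} → IsIdeal Q J → ∣ J ∣ ≤ r → r ≤ n → seen r J ≢ []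
  seen-nonempty idJ J≤r r≤n eq =
    let I , idI , I≡ , J⊆I , _ = between-full idJ J≤r r≤n
    in contradiction (subst (I ∈ₗ_) eq (∈-seen⁺ idI I≡ J⊆I)) λ ()

  seen-unique : ∀ r J → Unique (seen r J)
  seen-unique r J = Uniqueₚ.filter⁺ (J ⊆?_) (level-unique Q r)

  module _ (none : NoThree Q) where

    one-of-two : ∀ {A B C} → IsIdeal Q A → IsIdeal Q B → IsIdeal Q C → ∣ A ∣ ≡ ∣ B ∣ → ∣ A ∣ ≡ ∣ C ∣ →
      A ≢ B → C ≡ A ⊎ C ≡ B
    one-of-two {A} {B} {C} idA idB idC A≡B A≡C A≢B with ≡-dec 𝔹._≟_ C A | ≡-dec 𝔹._≟_ C B
    ... | yes C≡A | _       = inj₁ C≡A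
    ... | no _    | yes C≡B = inj₂ C≡B
    ... | no C≢A  | no C≢B  = ⊥-elim (none idA idB idC A≡B A≡C A≢B (≢-sym C≢A) (≢-sym C≢B))

    BelowNext : Subset n → Set
    BelowNext M = ∀ {K} → IsIdeal Q K → ∣ K ∣ ≡ suc ∣ M ∣ → M ⊆ K

    -- Every ideal larger than `M` contains an ideal with one element more than `M`.
    belowNext⇒below : ∀ {M K} → BelowNext M → IsIdeal Q K → ∣ M ∣ < ∣ K ∣ → M ⊆ K
    belowNext⇒below next idK M<K x∈M =
      let K' , idK' , K'≡ , _ , K'⊆K = between-∅ idK M<K in K'⊆K (next idK' K'≡ x∈M)

    -- Of two ideals of rank r, one is the meet of the ideals of rank r + 1 (when there are two of those).
    one-belowNext : ∀ {A B} → IsIdeal Q A → IsIdeal Q B → ∣ A ∣ ≡ ∣ B ∣ → A ≢ B →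
      BelowNext A ⊎ BelowNext B
    one-belowNext {A} {B} idA idB A≡B A≢B = cases (level Q (suc ∣ A ∣)) refl
      where
      cases : ∀ Ks → level Q (suc ∣ A ∣) ≡ Ks → BelowNext A ⊎ BelowNext B
      cases [] eq = inj₁ λ idK K≡ →
        contradiction (subst (_ ∈ₗ_) (trans (cong (level Q) K≡) eq) (∈-level⁺ Q idK)) λ ()
      cases (C ∷ []) eq = inj₁ λ {K} idK K≡ →
        let K' , idK' , K'≡ , A⊆K' , _ = between-full idA (ℕₚ.n≤1+n _) (subst (_≤ n) K≡ (∣p∣≤n K))
        in subst (A ⊆_) (trans (only idK' K'≡) (sym (only idK K≡))) A⊆K'
        where
        only : ∀ {K} → IsIdeal Q K → ∣ K ∣ ≡ suc ∣ A ∣ → K ≡ C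
        only idK K≡ with subst (_ ∈ₗ_) (trans (cong (level Q) K≡) eq) (∈-level⁺ Q idK)
        ... | here K≡C = K≡C
      cases (C ∷ D ∷ Ks) eq
        with subst Unique eq (level-unique Q (suc ∣ A ∣))
           | ∈-level⁻ Q (subst (C ∈ₗ_) (sym eq) (here refl)) | ∈-level⁻ Q (subst (D ∈ₗ_) (sym eq) (there (here refl)))
      ... | (C≢D ∷ _) ∷ _ | idC , C≡ | idD , D≡ = meet
        (one-of-two idA idB (∩-ideal Q idC idD) A≡B (sym size) A≢B)
        where
        -- A smaller meet would leave `C` and `D` with two elements each outside the other; a larger
        -- one would equal both `C` and `D`.
        big : ∣ A ∣ ≤ ∣ C ∩ D ∣
        big = ℕₚ.≮⇒≥ λ C∩D<A → no-2-2-differences Q none idC idD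
          (subst (2 + ∣ C ∩ D ∣ ≤_) (sym C≡) (s≤s C∩D<A)) (subst (2 + ∣ C ∩ D ∣ ≤_) (sym D≡) (s≤s C∩D<A))
        small : ∣ C ∩ D ∣ ≤ ∣ A ∣
        small = ℕₚ.≮⇒≥ λ A<C∩D → C≢D (trans
          (sym (⊆∧∣q∣≤∣p∣⇒≡ (p∩q⊆p C D) (subst (_≤ ∣ C ∩ D ∣) (sym C≡) A<C∩D)))
          (⊆∧∣q∣≤∣p∣⇒≡ (p∩q⊆q C D) (subst (_≤ ∣ C ∩ D ∣) (sym D≡) A<C∩D)))
        size : ∣ C ∩ D ∣ ≡ ∣ A ∣
        size = ℕₚ.≤-antisym small big
        meet-below : ∀ {K} → IsIdeal Q K → ∣ K ∣ ≡ suc ∣ A ∣ → C ∩ D ⊆ K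
        meet-below {K} idK K≡ with one-of-two idC idD idK (trans C≡ (sym D≡)) (trans C≡ (sym K≡)) C≢D
        ... | inj₁ refl = p∩q⊆p C D
        ... | inj₂ refl = p∩q⊆q C D
        meet : C ∩ D ≡ A ⊎ C ∩ D ≡ B → BelowNext A ⊎ BelowNext B
        meet (inj₁ refl) = inj₁ λ idK K≡ → meet-below idK (trans K≡ (cong suc size))
        meet (inj₂ refl) = inj₂ λ idK K≡ → meet-below idK (trans K≡ (cong suc size))

    -- An ideal of the next rank that contains `N` also contains `M`, hence `M ∪ N`, which already
    -- has at least that many elements. So there is only one such ideal and `flagh-single` applies.
    -- This is what rules out consecutive ranks.
    flagh-next : ∀ {M N rs} → IsIdeal Q M → IsIdeal Q N → ∣ M ∣ ≡ ∣ N ∣ → M ≢ N → BelowNext M →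
      suc ∣ N ∣ ≤ n → Ascending n (suc ∣ N ∣) rs → flagh (suc ∣ N ∣ ∷ rs) N ≡ + 0
    flagh-next {M} {N} {rs} idM idN M≡N M≢N next N<n a = cases (seen (suc ∣ N ∣) N) refl
      where
      cases : ∀ Is → seen (suc ∣ N ∣) N ≡ Is → flagh (suc ∣ N ∣ ∷ rs) N ≡ + 0
      cases [] eq = contradiction eq (seen-nonempty idN (ℕₚ.n≤1+n _) N<n)
      cases (I ∷ []) eq = flagh-single idN (ℕₚ.n≤1+n _) a eq
      cases (C ∷ D ∷ _) eq
        with subst Unique eq (seen-unique (suc ∣ N ∣) N)
           | ∈-seen⁻ {J = N} (subst (C ∈ₗ_) (sym eq) (here refl)) | ∈-seen⁻ {J = N} (subst (D ∈ₗ_) (sym eq) (there (here refl)))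
      ... | (C≢D ∷ _) ∷ _ | idC , C≡ , N⊆C | idD , D≡ , N⊆D =
        contradiction (trans (sym (join C N⊆C idC C≡)) (join D N⊆D idD D≡)) C≢D
        where
        N<M∪N : ∣ N ∣ < ∣ M ∪ N ∣
        N<M∪N = p⊂q⇒∣p∣<∣q∣ (q⊆p∪q M N , x , p⊆p∪q N x∈M , x∉N)
          where
          d = ⊈⇒∃ {p = M} {N} λ M⊆N → M≢N (⊆∧∣q∣≤∣p∣⇒≡ M⊆N (ℕₚ.≤-reflexive (sym M≡N)))
          x = proj₁ d
          x∈M = proj₁ (proj₂ d)
          x∉N = proj₂ (proj₂ d)
        join : ∀ K → N ⊆ K → IsIdeal Q K → ∣ K ∣ ≡ suc ∣ N ∣ → M ∪ N ≡ K
        join K N⊆K idK K≡ = ⊆∧∣q∣≤∣p∣⇒≡ sub (subst (_≤ ∣ M ∪ N ∣) (sym K≡) N<M∪N)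
          where
          sub : M ∪ N ⊆ K
          sub x∈ with x∈p∪q⁻ M N x∈
          ... | inj₁ x∈M = next idK (trans K≡ (cong suc (sym M≡N))) x∈M
          ... | inj₂ x∈N = N⊆K x∈N

    ZeroOrOne : List ℕ → Subset n → Set
    ZeroOrOne rs J = flagh rs J ≡ + 0 ⊎ (flagh rs J ≡ + 1 × NonConsecutive rs)

    -- Induction on the ranks, by the number of ideals of rank `r` containing `J`: there is at least
    -- one, a single one gives 0, two pass the value of the tail on through `flagh-pair`, and three
    -- are excluded. Sparsity travels along with the value 1.
    flagh-zeroOrOne : ∀ {o rs J} → Ascending n o rs → IsIdeal Q J → ∣ J ∣ ≤ o → ZeroOrOne rs J
    flagh-pair : ∀ {r rs M N J} → Ascending n r rs → IsIdeal Q M → IsIdeal Q N → ∣ M ∣ ≡ r → ∣ N ∣ ≡ r →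
      M ≢ N → BelowNext M → J ⊆ M → J ⊆ N → flagh (r ∷ rs) J ≡ flagh rs M ℤ.+ flagh rs N ℤ.- flagh rs J →
      ZeroOrOne (r ∷ rs) J

    flagh-zeroOrOne [] idJ J≤o = inj₂ (refl , [])
    flagh-zeroOrOne {o} {r ∷ rs} {J} ((o<r , r≤n) ∷ a) idJ J≤o = cases (seen r J) refl
      where
      J≤r = ℕₚ.≤-trans J≤o (ℕₚ.<⇒≤ o<r)
      cases : ∀ Is → seen r J ≡ Is → ZeroOrOne (r ∷ rs) J
      cases [] eq = contradiction eq (seen-nonempty idJ J≤r r≤n)
      cases (I ∷ []) eq = inj₁ (flagh-single idJ J≤r a eq)
      cases (A ∷ B ∷ Is) eq
        with subst Unique eq (seen-unique r J)
           | ∈-seen⁻ {J = J} (subst (A ∈ₗ_) (sym eq) (here refl)) | ∈-seen⁻ {J = J} (subst (B ∈ₗ_) (sym eq) (there (here refl)))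
      cases (A ∷ B ∷ C ∷ Is) eq | (A≢B ∷ A≢C ∷ _) ∷ (B≢C ∷ _) ∷ _ | idA , A≡ , _ | idB , B≡ , _
        with ∈-seen⁻ {J = J} (subst (C ∈ₗ_) (sym eq) (there (there (here refl))))
      ... | idC , C≡ , _ = ⊥-elim (none idA idB idC (trans A≡ (sym B≡)) (trans A≡ (sym C≡)) A≢B A≢C B≢C)
      cases (A ∷ B ∷ []) eq | (A≢B ∷ _) ∷ _ | idA , A≡ , J⊆A | idB , B≡ , J⊆B
        with one-belowNext idA idB (trans A≡ (sym B≡)) A≢B
      ... | inj₁ next = flagh-pair a idA idB A≡ B≡ A≢B next J⊆A J⊆B
        (trans (cong (λ l → sumℤ (map (flagh rs) l) ℤ.- flagh rs J) eq)
          (cong (λ s → flagh rs A ℤ.+ s ℤ.- flagh rs J) (ℤₚ.+-identityʳ (flagh rs B))))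
      ... | inj₂ next = flagh-pair a idB idA B≡ A≡ (≢-sym A≢B) next J⊆B J⊆A
        (trans (cong (λ l → sumℤ (map (flagh rs) l) ℤ.- flagh rs J) eq)
          (cong (ℤ._- flagh rs J) (trans (cong (λ s → flagh rs A ℤ.+ s) (ℤₚ.+-identityʳ (flagh rs B)))
            (ℤₚ.+-comm (flagh rs A) (flagh rs B)))))

    -- M and J lie below every ideal of rank greater than r, so their terms cancel and N's remains.
    flagh-pair {r} {rs} {M} {N} {J} a idM idN refl N≡ M≢N next J⊆M J⊆N expand =
      extend rs a (flagh-zeroOrOne a idN (ℕₚ.≤-reflexive N≡)) reduce
      where
      cancel : ∀ x y → x ℤ.+ y ℤ.- x ≡ y
      cancel = ℤ-Solver.solve-∀
      M≗J : flagh rs M ≡ flagh rs J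
      M≗J = flagh-cong {J = M} {J} a λ {K} idK r<K →
        mk⇔ {A = M ⊆ K} {B = J ⊆ K} (λ M⊆K x∈ → M⊆K (J⊆M x∈)) λ _ → belowNext⇒below next idK r<K
      reduce : flagh (r ∷ rs) J ≡ flagh rs N
      reduce = trans expand (trans (cong (λ x → flagh rs M ℤ.+ flagh rs N ℤ.- x) (sym M≗J)) (cancel (flagh rs M) (flagh rs N)))
      extend : ∀ rs → Ascending n ∣ M ∣ rs → ZeroOrOne rs N → flagh (r ∷ rs) J ≡ flagh rs N → ZeroOrOne (r ∷ rs) J
      extend rs _ (inj₁ is0) eq = inj₁ (trans eq is0)
      extend [] _ (inj₂ (one , _)) eq = inj₂ (trans eq one , [-])
      extend (r' ∷ rs) ((_ , r'≤n) ∷ a) (inj₂ (one , l)) eq = inj₂ (trans eq one , r'≢ ∷ l)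
        where
        -- Were `r'` the rank right after `r`, then `flagh-next` would make the value at `N` zero,
        -- not one.
        r'≢ : r' ≢ suc ∣ M ∣
        r'≢ r'≡ with trans r'≡ (cong suc (sym N≡))
        ... | refl = contradiction (trans (sym one) (flagh-next idM idN (sym N≡) M≢N next r'≤n a)) λ ()

    flagH-zeroOrOne : (S : Subset (n ∸ 1)) → flagH Q S ≡ + 0 ⊎ (flagH Q S ≡ + 1 × Sparse S)
    flagH-zeroOrOne S with flagh-zeroOrOne (ranks-ascending S 0 n (ℕₚ.m∸n≤m n 1)) (∅-ideal Q) (ℕₚ.≤-reflexive (∣⊥∣≡0 n))
    ... | inj₁ is0 = inj₁ (trans (flagH≡flagh S) is0)
    ... | inj₂ (one , l) = inj₂ (trans (flagH≡flagh S) one , nonConsecutive⇒sparse S 0 l)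

  flagH-⁅⁆ : (i : Fin (n ∸ 1)) → flagH Q ⁅ i ⁆ ≡ + rankCount Q (suc (toℕ i)) ℤ.- + 1
  flagH-⁅⁆ i = trans (flagH≡flagh ⁅ i ⁆) (trans (cong (λ rs → flagh rs ∅) (ranks-⁅⁆ 0 i))
    (cong (ℤ._- + 1) (trans (sumℤ-ones (seen r ∅)) (cong (+_ ∘ length)
      (filter-all (∅ ⊆?_) {level Q r} (All.tabulate λ _ → ⊥⊆))))))
    where r = suc (toℕ i)

  -- Ranks 0 and `n` lie outside the index range of the flag vectors, but only the empty and the
  -- full ideal have these sizes. For an inner rank, evaluate at the singleton: index `i` stands for
  -- rank `i + 1`, and one less than the number of ideals there is 0, 1 or -1.
  multiplicityFree⇒atMostTwo : MultiplicityFree Q → AtMostTwoPerRank Q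
  multiplicityFree⇒atMostTwo mf zero _ = ℕₚ.≤-trans
    (unique-constant⇒length≤1 (level Q 0) (level-unique Q 0) λ I∈ →
      sym (⊆∧∣q∣≤∣p∣⇒≡ ⊥⊆ (subst (_≤ ∣ ∅ {n} ∣) (sym (proj₂ (∈-level⁻ Q I∈))) z≤n)))
    (s≤s z≤n)
  multiplicityFree⇒atMostTwo mf (suc i) i<n with suc i ℕ.≟ n
  ... | yes refl = ℕₚ.≤-trans
    (unique-constant⇒length≤1 (level Q n) (level-unique Q n) λ I∈ → ∣p∣≡n⇒p≡⊤ (proj₂ (∈-level⁻ Q I∈)))
    (s≤s z≤n)
  ... | no i≢n = subst (λ k → rankCount Q (suc k) ≤ 2) (Finₚ.toℕ-fromℕ< i<n-1)
      (bound _ (subst (λ z → z ≡ + 0 ⊎ z ≡ + 1 ⊎ z ≡ - (+ 1)) (flagH-⁅⁆ (fromℕ< i<n-1)) (mf ⁅ fromℕ< i<n-1 ⁆)))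
    where
    i<n-1 : i < n ∸ 1
    i<n-1 = ℕₚ.m+n≤o⇒m≤o∸n (suc i) (subst (_≤ n) (ℕₚ.+-comm 1 (suc i)) (ℕₚ.≤∧≢⇒< i<n i≢n))
    bound : ∀ k → let z = + k ℤ.- + 1 in z ≡ + 0 ⊎ z ≡ + 1 ⊎ z ≡ - (+ 1) → k ≤ 2
    bound 0 _ = z≤n
    bound 1 _ = s≤s z≤n
    bound 2 _ = s≤s (s≤s z≤n)
    bound (suc (suc (suc k))) (inj₁ ())
    bound (suc (suc (suc k))) (inj₂ (inj₁ ()))
    bound (suc (suc (suc k))) (inj₂ (inj₂ ()))

  multiplicityFree⇔atMostTwo : MultiplicityFree Q ⇔ AtMostTwoPerRank Q
  multiplicityFree⇔atMostTwo = mk⇔ multiplicityFree⇒atMostTwo λ two S →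
    Sum.map₂ (inj₁ ∘ proj₁) (flagH-zeroOrOne (atMostTwo⇒noThree Q two) S)

  multiplicityFree⇒sparse : MultiplicityFree Q → ∀ S → ¬ (flagH Q S ≡ + 0) → Sparse S
  multiplicityFree⇒sparse mf S nonzero
    with flagH-zeroOrOne (atMostTwo⇒noThree Q (multiplicityFree⇒atMostTwo mf)) S
  ... | inj₁ is0 = contradiction is0 nonzero
  ... | inj₂ (_ , sparse) = sparse

-- Ordinal sums

T-injective : {a b : Bool} → (T a → T b) → (T b → T a) → a ≡ b
T-injective {false} {false} f g = refl
T-injective {false} {true}  f g = ⊥-elim (g _)
T-injective {true}  {false} f g = ⊥-elim (f _)
T-injective {true}  {true}  f g = refl

¬⇒T-not : {b : Bool} → ¬ T b → T (not b)
¬⇒T-not {true}  ¬b = ¬b _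
¬⇒T-not {false} _  = _

T-not⁻ : {b : Bool} → T (not b) → ¬ T b
T-not⁻ {false} _ ()

restrict : (f : Fin m → Fin n) → Injective _≡_ _≡_ f → Poset n → Poset m
restrict f inj Q = poset (λ a b → le Q (f a) (f b)) record
  { reflexive = λ a → reflexive (f a)
  ; antisym   = λ a b p q → inj (antisym (f a) (f b) p q)
  ; trans     = λ a b c → ≤-trans (f a) (f b) (f c)
  } where open IsPoset (isPoset Q) renaming (trans to ≤-trans)

-- A nontrivial ordinal sum decomposition read off inside the poset itself, with `A` as the lower
-- summand. It needs no relabelling and is easy to follow through extensions.
Cut : Rel n → Set
Cut {n} R = Σ (Fin n → Bool) λ A →
  (∃[ x ] T (A x)) × (∃[ y ] T (not (A y))) × (∀ {a b} → T (A a) → T (not (A b)) → T (R a b))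

isLeft : {A B : Set} → A ⊎ B → Bool
isLeft (inj₁ _) = true
isLeft (inj₂ _) = false

⊕-left-right : ∀ {k} (R₁ : Rel m) (R₂ : Rel k) x y →
  T (isLeft (splitAt m x)) → T (not (isLeft (splitAt m y))) → T ((R₁ ⊕ R₂) x y)
⊕-left-right {m} R₁ R₂ x y l r with splitAt m x | splitAt m y
... | inj₁ _ | inj₂ _ = _

ordinalSum⇒cut : (Q : Poset n) → IsNontrivialOrdinalSum Q → Cut (le Q)
ordinalSum⇒cut {n} Q (m , k , Q₁ , Q₂ , σ , pres) =
  A , (σ.to zero , subst (T ∘ side) (sym (σ.strictlyInverseʳ zero)) _)
    , (σ.to (suc m ↑ʳ zero) , subst (T ∘ not ∘ side) (sym (σ.strictlyInverseʳ (suc m ↑ʳ zero)))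
        (subst (T ∘ not ∘ isLeft) (sym (Finₚ.splitAt-↑ʳ (suc m) (suc k) zero)) _))
    , λ {a} {b} a∈ b∉ → subst T
        (trans (pres (σ.from a) (σ.from b)) (cong₂ (le Q) (σ.strictlyInverseˡ a) (σ.strictlyInverseˡ b)))
        (⊕-left-right (le Q₁) (le Q₂) (σ.from a) (σ.from b) a∈ b∉)
  where
  module σ = Inverse σ
  side : Fin (suc m + suc k) → Bool
  side = isLeft ∘ splitAt (suc m)
  A : Fin n → Bool
  A = side ∘ σ.from

Partition : (Fin n → Bool) → Set
Partition {n} A = ∃[ p ] ∃[ q ] Σ ((Fin p ⊎ Fin q) ↔ Fin n) λ e → ∀ z → A (Inverse.to e z) ≡ isLeft z

-- Sorting the elements by `A` provides the relabelling that turns a cut into an ordinal sum.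
partition : (A : Fin n → Bool) → Partition A
partition {zero}  A = 0 , 0 , mk↔ₛ′ (λ { (inj₁ ()) ; (inj₂ ()) }) (λ ()) (λ ()) (λ { (inj₁ ()) ; (inj₂ ()) })
                    , λ { (inj₁ ()) ; (inj₂ ()) }
partition {suc n} A with A zero in A₀ | partition (A ∘ suc)
... | true | p , q , e , side = suc p , q , mk↔ₛ′ f g f∘g g∘f , side'
  where
  module e = Inverse e
  f : Fin (suc p) ⊎ Fin q → Fin (suc n)
  f (inj₁ zero)    = zero
  f (inj₁ (suc i)) = suc (e.to (inj₁ i))
  f (inj₂ j)       = suc (e.to (inj₂ j))
  g : Fin (suc n) → Fin (suc p) ⊎ Fin q
  g zero    = inj₁ zero
  g (suc x) = Sum.map₁ suc (e.from x)
  f∘map : ∀ z → f (Sum.map₁ suc z) ≡ suc (e.to z)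
  f∘map (inj₁ _) = refl
  f∘map (inj₂ _) = refl
  f∘g : ∀ x → f (g x) ≡ x
  f∘g zero    = refl
  f∘g (suc x) = trans (f∘map (e.from x)) (cong suc (e.strictlyInverseˡ x))
  g∘f : ∀ z → g (f z) ≡ z
  g∘f (inj₁ zero)    = refl
  g∘f (inj₁ (suc i)) = cong (Sum.map₁ suc) (e.strictlyInverseʳ (inj₁ i))
  g∘f (inj₂ j)       = cong (Sum.map₁ suc) (e.strictlyInverseʳ (inj₂ j))
  side' : ∀ z → A (f z) ≡ isLeft z
  side' (inj₁ zero)    = A₀
  side' (inj₁ (suc i)) = side (inj₁ i)
  side' (inj₂ j)       = side (inj₂ j)
... | false | p , q , e , side = p , suc q , mk↔ₛ′ f g f∘g g∘f , side'
  where
  module e = Inverse e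
  f : Fin p ⊎ Fin (suc q) → Fin (suc n)
  f (inj₁ i)       = suc (e.to (inj₁ i))
  f (inj₂ zero)    = zero
  f (inj₂ (suc j)) = suc (e.to (inj₂ j))
  g : Fin (suc n) → Fin p ⊎ Fin (suc q)
  g zero    = inj₂ zero
  g (suc x) = Sum.map₂ suc (e.from x)
  f∘map : ∀ z → f (Sum.map₂ suc z) ≡ suc (e.to z)
  f∘map (inj₁ _) = refl
  f∘map (inj₂ _) = refl
  f∘g : ∀ x → f (g x) ≡ x
  f∘g zero    = refl
  f∘g (suc x) = trans (f∘map (e.from x)) (cong suc (e.strictlyInverseˡ x))
  g∘f : ∀ z → g (f z) ≡ z
  g∘f (inj₁ i)       = cong (Sum.map₂ suc) (e.strictlyInverseʳ (inj₁ i))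
  g∘f (inj₂ zero)    = refl
  g∘f (inj₂ (suc j)) = cong (Sum.map₂ suc) (e.strictlyInverseʳ (inj₂ j))
  side' : ∀ z → A (f z) ≡ isLeft z
  side' (inj₁ i)       = side (inj₁ i)
  side' (inj₂ zero)    = A₀
  side' (inj₂ (suc j)) = side (inj₂ j)

cut⇒ordinalSum : (Q : Poset n) → Cut (le Q) → IsNontrivialOrdinalSum Q
cut⇒ordinalSum {n} Q (A , (x , x∈A) , (y , y∉A) , below) with partition A
... | p , q , e , side = build p q e side (e.from x) (e.strictlyInverseˡ x) (e.from y) (e.strictlyInverseˡ y)
  where
  module e = Inverse e
  open IsPoset (isPoset Q) using (antisym)
  -- `p`, `q` and `e` are generalised so that matching on the preimages of `x` and `y` reveals both
  -- sizes as successors, which the nonempty summands require.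
  build : ∀ p q (e : (Fin p ⊎ Fin q) ↔ Fin n) → (∀ z → A (Inverse.to e z) ≡ isLeft z) →
    ∀ u → Inverse.to e u ≡ x → ∀ v → Inverse.to e v ≡ y → IsNontrivialOrdinalSum Q
  build p q e side (inj₂ j) refl _ _ = ⊥-elim (subst T (side (inj₂ j)) x∈A)
  build p q e side (inj₁ i) _ (inj₁ j) refl = ⊥-elim (subst (T ∘ not) (side (inj₁ j)) y∉A)
  build (suc p) (suc q) e side (inj₁ _) _ (inj₂ _) _ =
    p , q , restrict (e'.to ∘ inj₁) (Sum-inj₁ ∘ e'-injective) Q , restrict (e'.to ∘ inj₂) (Sum-inj₂ ∘ e'-injective) Q
      , (e ↔-∘ Finₚ.+↔⊎ {suc p}) , pres
    where
    module e' = Inverse e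
    Sum-inj₁ : ∀ {i j} → inj₁ {B = Fin (suc q)} i ≡ inj₁ j → i ≡ j
    Sum-inj₁ refl = refl
    Sum-inj₂ : ∀ {i j} → inj₂ {A = Fin (suc p)} i ≡ inj₂ j → i ≡ j
    Sum-inj₂ refl = refl
    e'-injective : ∀ {u v} → e'.to u ≡ e'.to v → u ≡ v
    e'-injective {u} {v} eq = trans (sym (e'.strictlyInverseʳ u)) (trans (cong e'.from eq) (e'.strictlyInverseʳ v))
    above : ∀ i j → T (le Q (e'.to (inj₁ i)) (e'.to (inj₂ j)))
    above i j = below (subst T (sym (side (inj₁ i))) _) (subst (T ∘ not) (sym (side (inj₂ j))) _)
    pres : ∀ a b → ((λ i j → le Q (e'.to (inj₁ i)) (e'.to (inj₁ j))) ⊕ (λ i j → le Q (e'.to (inj₂ i)) (e'.to (inj₂ j)))) a b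
      ≡ le Q (e'.to (splitAt (suc p) a)) (e'.to (splitAt (suc p) b))
    pres a b with splitAt (suc p) a | splitAt (suc p) b
    ... | inj₁ i | inj₁ j = refl
    ... | inj₁ i | inj₂ j = T-injective (λ _ → above i j) (λ _ → _)
    ... | inj₂ i | inj₂ j = refl
    ... | inj₂ i | inj₁ j = T-injective (λ ()) λ ge → contradiction
      (e'-injective (antisym _ _ ge (above j i))) λ ()

module _ (Q : Poset n) where
  open IsPoset (isPoset Q) renaming (trans to ≤-trans)

  -- An ideal with an element outside the lower part `I` contains all of `I`. So every ideal is
  -- contained in `I` or contains it, and one of the same size equals it.
  cut⇒rankCount≤1 : Cut (le Q) → ∃[ i ] (1 ≤ i × i ≤ n ∸ 1 × rankCount Q i ≤ 1)
  cut⇒rankCount≤1 (A , (x , x∈A) , (y , y∉A) , below) = ∣ I ∣ , 1≤I , I≤n-1 ,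
    unique-constant⇒length≤1 (level Q ∣ I ∣) (level-unique Q ∣ I ∣) λ K∈ → only (∈-level⁻ Q K∈)
    where
    I : Subset n
    I = tabulate A
    ∉I : ∀ {z} → z ∉ I → T (not (A z))
    ∉I {z} z∉ with A z in eq
    ... | true  = z∉ (∈-tabulate⁺ A (subst T (sym eq) _))
    ... | false = _
    y∉I : y ∉ I
    y∉I y∈ = T-not⁻ y∉A (∈-tabulate⁻ A y∈)
    1≤I : 1 ≤ ∣ I ∣
    1≤I = subst (_< ∣ I ∣) (∣⊥∣≡0 n) (p⊂q⇒∣p∣<∣q∣ (⊥⊆ , x , ∈-tabulate⁺ A x∈A , ∉⊥))
    I≤n-1 : ∣ I ∣ ≤ n ∸ 1
    I≤n-1 = ℕₚ.m+n≤o⇒m≤o∸n ∣ I ∣ (subst (_≤ n) (ℕₚ.+-comm 1 ∣ I ∣)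
      (subst (∣ I ∣ <_) (∣⊤∣≡n n) (p⊂q⇒∣p∣<∣q∣ (⊆⊤ , y , ∈⊤ , y∉I))))
    only : ∀ {K} → IsIdeal Q K × ∣ K ∣ ≡ ∣ I ∣ → K ≡ I
    only {K} (idK , K≡I) with K ⊆? I
    ... | yes K⊆I = ⊆∧∣q∣≤∣p∣⇒≡ K⊆I (ℕₚ.≤-reflexive (sym K≡I))
    ... | no K⊈I with ⊈⇒∃ K⊈I
    ... | z , z∈K , z∉I = sym (⊆∧∣q∣≤∣p∣⇒≡
      (λ a∈I → idK (below (∈-tabulate⁻ A a∈I) (∉I z∉I)) z∈K) (ℕₚ.≤-reflexive K≡I))

  -- If a ∈ I and b ∉ I were not a ≤ b, the ideal of all x ≱ a would contain b but not a, hence be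
  -- neither above nor below I.
  single⇒cut : ∀ {i I} → 1 ≤ i → i ≤ n ∸ 1 → level Q i ≡ I ∷ [] → Cut (le Q)
  single⇒cut {i} {I} 1≤i i≤n-1 eq = lookup I , inside , outside , below
    where
    idI : IsIdeal Q I
    idI = proj₁ (∈-level⁻ Q (subst (I ∈ₗ_) (sym eq) (here refl)))
    I≡i : ∣ I ∣ ≡ i
    I≡i = proj₂ (∈-level⁻ Q (subst (I ∈ₗ_) (sym eq) (here refl)))
    i<n : i < n
    i<n = positive n i≤n-1
      where
      positive : ∀ n → i ≤ n ∸ 1 → i < n
      positive zero    i≤0 = contradiction (ℕₚ.≤-trans 1≤i i≤0) λ ()
      positive (suc n) i≤n = s≤s i≤n
    only : ∀ {K} → IsIdeal Q K → ∣ K ∣ ≡ i → K ≡ I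
    only {K} idK refl with subst (K ∈ₗ_) eq (∈-level⁺ Q idK)
    ... | here K≡I = K≡I
    inside : ∃[ x ] T (lookup I x)
    inside with ∣p∣<∣q∣⇒∃ {p = ∅} {I} (subst₂ _<_ (sym (∣⊥∣≡0 n)) (sym I≡i) 1≤i)
    ... | x , x∈I , _ = x , T-≡ .from ([]=⇒lookup x∈I)
    outside : ∃[ y ] T (not (lookup I y))
    outside with ∣p∣<∣q∣⇒∃ {p = I} {full} (subst₂ _<_ (sym I≡i) (sym (∣⊤∣≡n n)) i<n)
    ... | y , _ , y∉I = y , ∉⇒T-not {p = I} y∉I
    below : ∀ {a b} → T (lookup I a) → T (not (lookup I b)) → T (le Q a b)
    below {a} {b} a∈ b∉ = decidable-stable (T? (le Q a b)) λ a≰b →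
      absurd (∈-tabulate⁺ _ (¬⇒T-not a≰b)) (ℕₚ.≤-total ∣ K ∣ i)
      where
      K : Subset n
      K = tabulate (λ x → not (le Q a x))
      idK : IsIdeal Q K
      idK {x} {y} x≤y y∈ = ∈-tabulate⁺ _ (¬⇒T-not λ a≤x → T-not⁻ (∈-tabulate⁻ _ y∈) (≤-trans a x y a≤x x≤y))
      absurd : b ∈ K → ∣ K ∣ ≤ i ⊎ i ≤ ∣ K ∣ → ⊥
      absurd b∈K (inj₁ K≤i) with between-full Q idK K≤i (ℕₚ.<⇒≤ i<n)
      ... | I' , idI' , I'≡ , K⊆I' , _ with only idI' I'≡
      ... | refl = T-not⁻ b∉ (T-≡ .from ([]=⇒lookup (K⊆I' b∈K)))
      absurd b∈K (inj₂ i≤K) with between-∅ Q idK i≤K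
      ... | I' , idI' , I'≡ , _ , I'⊆K with only idI' I'≡
      ... | refl = T-not⁻ (∈-tabulate⁻ _ (I'⊆K (lookup⇒[]= a I (T-≡ .to a∈)))) (reflexive a)

  -- Every rank has one or two ideals by (b), so the question is whether some inner rank has a
  -- single ideal, which amounts to a cut.
  indecomposable⇔two : ForbiddenFree Q →
    (¬ IsNontrivialOrdinalSum Q) ⇔ (∀ i → 1 ≤ i → i ≤ n ∸ 1 → rankCount Q i ≡ 2)
  indecomposable⇔two free = mk⇔ two notSum
    where
    two : ¬ IsNontrivialOrdinalSum Q → ∀ i → 1 ≤ i → i ≤ n ∸ 1 → rankCount Q i ≡ 2
    two notSum i 1≤i i≤n-1 = cases (level Q i) refl (atMostTwo⇔forbiddenFree Q .from free i i≤n)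
      where
      i≤n = ℕₚ.≤-trans i≤n-1 (ℕₚ.m∸n≤m n 1)
      cases : ∀ Is → level Q i ≡ Is → rankCount Q i ≤ 2 → rankCount Q i ≡ 2
      cases []           eq _ with between-∅ Q (full-ideal Q) (subst (i ≤_) (sym (∣⊤∣≡n n)) i≤n)
      ... | I , idI , refl , _ = contradiction (subst (I ∈ₗ_) eq (∈-level⁺ Q idI)) λ ()
      cases (I ∷ [])     eq _ = contradiction (cut⇒ordinalSum Q (single⇒cut 1≤i i≤n-1 eq)) notSum
      cases (_ ∷ _ ∷ []) eq _ = cong length eq
      cases (_ ∷ _ ∷ _ ∷ _) eq ≤2 = contradiction (subst (_≤ 2) (cong length eq) ≤2) λ { (s≤s (s≤s ())) }
    notSum : (∀ i → 1 ≤ i → i ≤ n ∸ 1 → rankCount Q i ≡ 2) → ¬ IsNontrivialOrdinalSum Q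
    notSum two sum with cut⇒rankCount≤1 (ordinalSum⇒cut Q sum)
    ... | i , 1≤i , i≤n-1 , ≤1 = contradiction (subst (_≤ 1) (two i 1≤i i≤n-1) ≤1) λ { (s≤s ()) }

-- Isomorphisms

-- Unlike _≅_, this lets R and R' be inferred from the type of an isomorphism.
record _≃_ (R : Rel n) (R' : Rel m) : Set where
  constructor _,_
  field
    perm : Fin n ↔ Fin m
    pres : ∀ x y → R x y ≡ R' (Inverse.to perm x) (Inverse.to perm y)

≅⇒≃ : {R : Rel n} {R' : Rel m} → R ≅ R' → R ≃ R'
≅⇒≃ (σ , pres) = σ , pres

≃⇒≅ : {R : Rel n} {R' : Rel m} → R ≃ R' → R ≅ R'
≃⇒≅ (σ , pres) = σ , pres

image : {R : Rel n} {R' : Rel m} → R ≃ R' → Fin n → Fin m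
image (σ , _) = Inverse.to σ

≃-refl : {R : Rel n} → R ≃ R
≃-refl = ↔-id _ , λ _ _ → refl

≃-sym : {R : Rel n} {R' : Rel m} → R ≃ R' → R' ≃ R
≃-sym {R' = R'} (σ , pres) = ↔-sym σ , λ x y →
  sym (trans (pres (σ.from x) (σ.from y)) (cong₂ R' (σ.strictlyInverseˡ x) (σ.strictlyInverseˡ y)))
  where module σ = Inverse σ

≃-trans : ∀ {k} {R : Rel n} {R' : Rel m} {R'' : Rel k} → R ≃ R' → R' ≃ R'' → R ≃ R''
≃-trans (σ , pres) (τ , pres') = (τ ↔-∘ σ) , λ x y → trans (pres x y) (pres' (Inverse.to σ x) (Inverse.to σ y))

image-injective : {R : Rel n} {R' : Rel m} (i : R ≃ R') {x y : Fin n} → image i x ≡ image i y → x ≡ y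
image-injective (σ , _) {x} {y} eq = trans (sym (σ.strictlyInverseʳ x)) (trans (cong σ.from eq) (σ.strictlyInverseʳ y))
  where module σ = Inverse σ

image-≤ : {R : Rel n} {R' : Rel m} (i : R ≃ R') {x y : Fin n} → T (R x y) → T (R' (image i x) (image i y))
image-≤ (_ , pres) = subst T (pres _ _)

image-≤⁻ : {R : Rel n} {R' : Rel m} (i : R ≃ R') {x y : Fin n} → T (R' (image i x) (image i y)) → T (R x y)
image-≤⁻ (_ , pres) = subst T (sym (pres _ _))

preimage : {R : Rel n} {R' : Rel m} (i : R ≃ R') (y : Fin m) → ∃[ x ] image i x ≡ y
preimage (σ , _) y = Inverse.from σ y , Inverse.strictlyInverseˡ σ y

image-maximal : {R : Rel n} {R' : Rel m} (i : R ≃ R') {x : Fin n} → Maximal R x → Maximal R' (image i x)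
image-maximal i max {y} x≤y with preimage i y
... | z , refl = cong (image i) (max (image-≤⁻ i x≤y))

-- Adjoining an element above all elements but possibly one

above : Maybe (Fin n) → Fin n → Bool
above nothing  a = true
above (just x) a = not ⌊ a Finₚ.≟ x ⌋

above-⁺ : {x a : Fin n} → a ≢ x → T (above (just x) a)
above-⁺ {x = x} {a} a≢x with a Finₚ.≟ x
... | yes a≡x = a≢x a≡x
... | no _    = _

above-⁻ : {x a : Fin n} → T (above (just x) a) → a ≢ x
above-⁻ {x = x} {a} t with a Finₚ.≟ x
... | no a≢x = a≢x

ext : Rel n → Maybe (Fin n) → Rel (suc n)
ext R e zero    zero    = true
ext R e zero    (suc b) = false
ext R e (suc a) zero    = above e a
ext R e (suc a) (suc b) = R a b

-- Maximality of the exempted `x` is what transitivity requires: if `b` is below the new element and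
-- `a ≤ b`, then `a` is not `x`, since otherwise `b` would be `x` too.
ext-isPoset : {R : Rel n} {e : Maybe (Fin n)} → IsPoset R → MAll.All (Maximal R) e → IsPoset (ext R e)
ext-isPoset {R = R} {e} P maxe = record { reflexive = rfl ; antisym = asym ; trans = tr }
  where
  open IsPoset P renaming (trans to ≤-trans)
  down : ∀ {e} → MAll.All (Maximal R) e → ∀ a b → T (R a b) → T (above e b) → T (above e a)
  down nothing a b a≤b _ = _
  down (just max) a b a≤b b≢ = above-⁺ λ { refl → above-⁻ b≢ (max a≤b) }
  rfl : ∀ x → T (ext R e x x)
  rfl zero    = _
  rfl (suc x) = reflexive x
  asym : ∀ x y → T (ext R e x y) → T (ext R e y x) → x ≡ y
  asym zero    zero    _ _ = refl
  asym (suc x) (suc y) p q = cong suc (antisym x y p q)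
  asym (suc x) zero    _ ()
  tr : ∀ x y z → T (ext R e x y) → T (ext R e y z) → T (ext R e x z)
  tr zero    zero    z       _ q = q
  tr (suc x) zero    zero    p _ = p
  tr (suc x) (suc y) zero    p q = down maxe x y p q
  tr (suc x) (suc y) (suc z) p q = ≤-trans x y z p q

ext-zero-maximal : {R : Rel n} {e : Maybe (Fin n)} → Maximal (ext R e) zero
ext-zero-maximal {y = zero} _ = refl

ext-suc-maximal : {R : Rel n} {x : Fin n} → Maximal R x → Maximal (ext R (just x)) (suc x)
ext-suc-maximal max {zero}  t = contradiction refl (above-⁻ t)
ext-suc-maximal max {suc y} t = cong suc (max t)

ext-maximal⁻ : {R : Rel n} {x : Fin n} {y : Fin (suc n)} → Maximal (ext R (just x)) y → y ≡ zero ⊎ y ≡ suc x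
ext-maximal⁻ {y = zero} max = inj₁ refl
ext-maximal⁻ {x = x} {suc y} max with y Finₚ.≟ x
... | yes refl = inj₂ refl
... | no y≢x   = contradiction (max {zero} (above-⁺ y≢x)) λ ()

extend : (Q : Poset n) (e : Maybe (Fin n)) → MAll.All (Maximal (le Q)) e → Poset (suc n)
extend Q e maxe = poset (ext (le Q) e) (ext-isPoset (isPoset Q) maxe)

-- The new element is maximal and incomparable to at most one element. In a 3-antichain or at the
-- top of a chain of a 2+2 it would be incomparable to two elements; at the bottom of a chain it
-- would not be maximal.
extend-free : (Q : Poset n) (e : Maybe (Fin n)) (maxe : MAll.All (Maximal (le Q)) e) →
  ForbiddenFree Q → ForbiddenFree (extend Q e maxe)
extend-free {n} Q e maxe (no22 , no111) = no22' , no111'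
  where
  E : Poset (suc n)
  E = extend Q e maxe
  sym∥ : ∀ {u v} → Incomparable E u v → Incomparable E v u
  sym∥ (p , q) = q , p
  exception : ∀ {u} → Incomparable E zero u → ∃[ x ] (e ≡ just x × u ≡ suc x)
  exception {zero} (p , _) = contradiction _ p
  exception {suc u} (_ , p) = lemma e p
    where
    lemma : ∀ e → ¬ T (above e u) → ∃[ x ] (e ≡ just x × suc u ≡ suc x)
    lemma nothing  ¬t = contradiction _ ¬t
    lemma (just x) ¬t = x , refl , cong suc (decidable-stable (u Finₚ.≟ x) (¬t ∘ above-⁺))
  unique-∥ : ∀ u v → Incomparable E zero u → Incomparable E zero v → u ≡ v
  unique-∥ u v p q with exception {u} p | exception {v} q
  ... | x , refl , refl | .x , refl , refl = refl
  irrefl : ∀ u v → Incomparable E u v → u ≢ v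
  irrefl u .u (p , _) refl = p (IsPoset.reflexive (isPoset E) u)
  no22' : TwoPlusTwoFree E
  no22' (zero , b , _ , _ , (a≤b , a≢b) , _) = a≢b (sym (ext-zero-maximal {R = le Q} {e} a≤b))
  no22' (suc _ , zero , c , d , _ , (_ , c≢d) , _ , _ , bc , bd) = c≢d (unique-∥ c d bc bd)
  no22' (suc _ , suc _ , zero , d , _ , (c≤d , c≢d) , _) = c≢d (sym (ext-zero-maximal {R = le Q} {e} c≤d))
  no22' (suc a , suc b , suc _ , zero , (_ , a≢b) , _ , _ , ad , _ , bd) =
    a≢b (unique-∥ (suc a) (suc b) (sym∥ {suc a} {zero} ad) (sym∥ {suc b} {zero} bd))
  no22' (suc a , suc b , suc c , suc d , (a≤b , a≢b) , (c≤d , c≢d) , rest) =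
    no22 (a , b , c , d , (a≤b , a≢b ∘ cong suc) , (c≤d , c≢d ∘ cong suc) , rest)
  no111' : OnePlusOnePlusOneFree E
  no111' (zero , b , c , ab , ac , bc) = irrefl b c bc (unique-∥ b c ab ac)
  no111' (suc a , zero , c , ab , ac , bc) =
    irrefl (suc a) c ac (unique-∥ (suc a) c (sym∥ {suc a} {zero} ab) bc)
  no111' (suc a , suc b , zero , ab , ac , bc) =
    irrefl (suc a) (suc b) ab (unique-∥ (suc a) (suc b) (sym∥ {suc a} {zero} ac) (sym∥ {suc b} {zero} bc))
  no111' (suc a , suc b , suc c , rest) = no111 (a , b , c , rest)

ext-cong : {R : Rel n} {R' : Rel m} (i : R ≃ R') (e : Maybe (Fin n)) → ext R e ≃ ext R' (Maybe.map (image i) e)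
ext-cong {R = R} {R'} i@(σ , pres) e = Perm.lift₀ σ , pres'
  where
  above-image : ∀ e a → above e a ≡ above (Maybe.map (image i) e) (image i a)
  above-image nothing  a = refl
  above-image (just x) a = T-injective
    (λ t → above-⁺ (above-⁻ t ∘ image-injective i)) (λ t → above-⁺ (above-⁻ t ∘ cong (image i)))
  pres' : ∀ x y → ext R e x y ≡ ext R' (Maybe.map (image i) e) (Inverse.to (Perm.lift₀ σ) x) (Inverse.to (Perm.lift₀ σ) y)
  pres' zero    zero    = refl
  pres' zero    (suc b) = refl
  pres' (suc a) zero    = above-image e a
  pres' (suc a) (suc b) = pres a b

ext-uncong : {R R' : Rel n} {e e' : Maybe (Fin n)} (i : ext R e ≃ ext R' e') → image i zero ≡ zero →
  Σ (R ≃ R') λ j → ∀ a → above e a ≡ above e' (image j a)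
ext-uncong {R = R} {R'} {e} {e'} (σ , pres) σ0≡0 =
  (τ , λ a b → trans (pres (suc a) (suc b)) (cong₂ (ext R' e') (σ-suc a) (σ-suc b)))
  , λ a → trans (pres (suc a) zero) (cong₂ (ext R' e') (σ-suc a) σ0≡0)
  where
  τ = Perm.remove zero σ
  σ-suc : ∀ a → Inverse.to σ (suc a) ≡ suc (Inverse.to τ a)
  σ-suc a = trans (Perm.punchIn-permute σ zero a) (cong (λ z → punchIn z (Inverse.to τ a)) σ0≡0)

-- Every nonempty poset as in (c) arises by adjoining an element.

free-restrict : (f : Fin m → Fin n) (inj : ∀ {x y} → f x ≡ f y → x ≡ y) (Q : Poset n) →
  ForbiddenFree Q → ForbiddenFree (restrict f inj Q)
free-restrict f inj Q (no22 , no111) =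
  (λ (a , b , c , d , (a≤b , a≢b) , (c≤d , c≢d) , rest) →
    no22 (f a , f b , f c , f d , (a≤b , a≢b ∘ inj) , (c≤d , c≢d ∘ inj) , rest)) ,
  (λ (a , b , c , rest) → no111 (f a , f b , f c , rest))

_∖_ : Poset (suc n) → Fin (suc n) → Poset n
Q ∖ y = restrict (punchIn y) (Finₚ.punchIn-injective y _ _) Q

module _ (Q : Poset (suc n)) where
  open IsPoset (isPoset Q) renaming (trans to ≤-trans)

  IsExtension : Set
  IsExtension = ∃[ y ] Σ (Maybe (Fin n)) λ e → MAll.All (Maximal (le (Q ∖ y))) e × (ext (le (Q ∖ y)) e ≃ le Q)

  extension : ∀ y (e : Maybe (Fin n)) → Maximal (le Q) y → MAll.All (Maximal (le (Q ∖ y))) e →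
    (∀ a → above e a ≡ le Q (punchIn y a) y) → IsExtension
  extension y e maxy maxe eq = y , e , maxe , (Perm.insert zero y Perm.id , pres)
    where
    pres : ∀ u v → ext (le (Q ∖ y)) e u v ≡ le Q (Inverse.to (Perm.insert zero y Perm.id) u) (Inverse.to (Perm.insert zero y Perm.id) v)
    pres zero    zero    = T-injective (λ _ → reflexive y) (λ _ → _)
    pres zero    (suc b) = T-injective (λ ()) (λ y≤b → contradiction (maxy y≤b) (Finₚ.punchInᵢ≢i y b))
    pres (suc a) zero    = eq a
    pres (suc a) (suc b) = refl

  extension-top : ∀ y → Maximal (le Q) y → (∀ z → T (le Q z y)) → IsExtension
  extension-top y maxy top = extension y nothing maxy nothing λ a → T-injective (λ _ → top (punchIn y a)) (λ _ → _)

  extension-but-one : ∀ {x y} → Maximal (le Q) x → Maximal (le Q) y → ¬ T (le Q x y) →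
    (∀ z → z ≢ x → T (le Q z y)) → IsExtension
  extension-but-one {x} {y} maxx maxy x≰y above-all = extension y (just (punchOut y≢x)) maxy
    (just λ {b} x≤b → Finₚ.punchIn-injective y _ _ (trans (maxx (subst (λ z → T (le Q z (punchIn y b))) back x≤b)) (sym back)))
    λ a → T-injective
      (λ a≢ → above-all (punchIn y a) λ eq → above-⁻ a≢ (Finₚ.punchIn-injective y _ _ (trans eq (sym back))))
      (λ a≤y → above-⁺ λ { refl → x≰y (subst (λ z → T (le Q z y)) back a≤y) })
    where
    y≢x : y ≢ x
    y≢x refl = x≰y (reflexive x)
    back : punchIn y (punchOut y≢x) ≡ x
    back = Finₚ.punchIn-punchOut y≢x

  -- If neither of two maximal elements lay above everything but the other, the witnesses would form a 2+2.
  free⇒extension : ForbiddenFree Q → IsExtension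
  free⇒extension (no22 , no111) with minimal-below (flip-isPoset (isPoset Q)) (λ _ → true) zero _
  ... | m₁ , _ , _ , max₁ with Finₚ.any? (λ z → ¬? (T? (le Q z m₁)))
  ... | no all = extension-top m₁ (max₁ _) λ z → decidable-stable (T? (le Q z m₁)) λ z≰ → all (z , z≰)
  -- `m₂` is maximal among the elements not below `m₁`. It is maximal in `Q` as well, because
  -- whatever lies above it is not below `m₁` either.
  ... | yes (z , z≰m₁) with minimal-below (flip-isPoset (isPoset Q)) (λ w → not (le Q w m₁)) z (¬⇒T-not z≰m₁)
  ... | m₂ , m₂≰ , _ , max₂ = choose
      (Finₚ.any? (λ w → ¬? (w Finₚ.≟ m₂) ×-dec ¬? (T? (le Q w m₁))))
      (Finₚ.any? (λ w → ¬? (w Finₚ.≟ m₁) ×-dec ¬? (T? (le Q w m₂))))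
    where
    m₂≰m₁ : ¬ T (le Q m₂ m₁)
    m₂≰m₁ = T-not⁻ m₂≰
    maximal₂ : Maximal (le Q) m₂
    maximal₂ {w} m₂≤w = max₂ (¬⇒T-not λ w≤m₁ → m₂≰m₁ (≤-trans m₂ w m₁ m₂≤w w≤m₁)) m₂≤w
    m₁≰m₂ : ¬ T (le Q m₁ m₂)
    m₁≰m₂ m₁≤m₂ = m₂≰m₁ (subst (λ w → T (le Q w m₁)) (sym (max₁ _ m₁≤m₂)) (reflexive m₁))
    covered : ∀ w → ¬ T (le Q w m₁) → w ≢ m₂ → T (le Q w m₂)
    covered w w≰m₁ w≢m₂ = decidable-stable (T? (le Q w m₂)) λ w≰m₂ → no111
      (w , m₁ , m₂ , (w≰m₁ , λ m₁≤w → w≰m₁ (subst (λ v → T (le Q v m₁)) (sym (max₁ _ m₁≤w)) (reflexive m₁)))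
        , (w≰m₂ , λ m₂≤w → w≢m₂ (maximal₂ m₂≤w)) , (m₁≰m₂ , m₂≰m₁))
    choose : Dec (∃[ w ] (w ≢ m₂ × ¬ T (le Q w m₁))) → Dec (∃[ w ] (w ≢ m₁ × ¬ T (le Q w m₂))) → IsExtension
    choose (no none) _ = extension-but-one maximal₂ (max₁ _) m₂≰m₁
      λ w w≢ → decidable-stable (T? (le Q w m₁)) λ w≰ → none (w , w≢ , w≰)
    choose (yes _) (no none) = extension-but-one (max₁ _) maximal₂ m₁≰m₂
      λ w w≢ → decidable-stable (T? (le Q w m₂)) λ w≰ → none (w , w≢ , w≰)
    choose (yes (u , u≢m₂ , u≰m₁)) (yes (v , v≢m₁ , v≰m₂)) = ⊥-elim (no22
      (u , m₂ , v , m₁ , (u≤m₂ , u≢m₂) , (v≤m₁ , v≢m₁)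
        , ((λ u≤v → u≰m₁ (≤-trans u v m₁ u≤v v≤m₁)) , (λ v≤u → v≰m₂ (≤-trans v u m₂ v≤u u≤m₂)))
        , (u≰m₁ , λ m₁≤u → m₁≰m₂ (≤-trans m₁ u m₂ m₁≤u u≤m₂))
        , ((λ m₂≤v → m₂≰m₁ (≤-trans m₂ v m₁ m₂≤v v≤m₁)) , v≰m₂)
        , (m₂≰m₁ , m₁≰m₂)))
      where
      u≤m₂ = covered u u≰m₁ u≢m₂
      v≤m₁ : T (le Q v m₁)
      v≤m₁ = decidable-stable (T? (le Q v m₁)) λ v≰m₁ → v≰m₂ (covered v v≰m₁ λ { refl → v≰m₂ (reflexive v) })

-- Isomorphisms and cuts of extensions.

Greatest : Rel n → Fin n → Set
Greatest R x = ∀ a → T (R a x)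

-- If `zero` is the greatest element of `R`, then it and the element adjoined beside it have the
-- same elements below them and can be exchanged.
ext-swap : {R : Rel (suc n)} → Maximal R zero → Greatest R zero →
  ext R (just zero) ≃ ext R (just zero)
ext-swap {n} {R} max top = mk↔ₛ′ f f f∘f f∘f , pres
  where
  f : Fin (suc (suc n)) → Fin (suc (suc n))
  f zero          = suc zero
  f (suc zero)    = zero
  f (suc (suc a)) = suc (suc a)
  f∘f : ∀ a → f (f a) ≡ a
  f∘f zero          = refl
  f∘f (suc zero)    = refl
  f∘f (suc (suc a)) = refl
  true≡ : ∀ a → true ≡ R a zero
  true≡ a = T-injective (λ _ → top a) (λ _ → _)
  false≡ : ∀ b → false ≡ R zero (suc b)
  false≡ b = T-injective (λ ()) (λ t → contradiction (max t) λ ())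
  pres : ∀ x y → ext R (just zero) x y ≡ ext R (just zero) (f x) (f y)
  pres zero          zero          = true≡ zero
  pres zero          (suc zero)    = refl
  pres zero          (suc (suc b)) = false≡ b
  pres (suc zero)    zero          = refl
  pres (suc zero)    (suc zero)    = sym (true≡ zero)
  pres (suc zero)    (suc (suc b)) = sym (false≡ b)
  pres (suc (suc a)) zero          = true≡ (suc a)
  pres (suc (suc a)) (suc zero)    = sym (true≡ (suc a))
  pres (suc (suc a)) (suc (suc b)) = refl

-- The new element is maximal, so its image is `zero` or `suc x'`. In the second case `suc x` must
-- go to `zero`. As the new element of each extension has only the exempted element not below it,
-- `suc x` and `suc x'` then lie above every old element, which makes `x` and `x'` greatest.
align : {R R' : Rel n} {x x' : Fin n} (i : ext R (just x) ≃ ext R' (just x')) →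
  image i zero ≡ zero ⊎ (image i zero ≡ suc x' × Greatest R x × Greatest R' x')
align {n} {R} {R'} {x} {x'} i with ext-maximal⁻ {R = R'} {x'} (image-maximal i (ext-zero-maximal {R = R} {just x}))
... | inj₁ fix = inj₁ fix
... | inj₂ swp = inj₂ (swp , greatest , greatest')
  where
  below : ∀ w → w ≢ suc x → T (ext R (just x) w zero)
  below zero    _  = _
  below (suc w) w≢ = above-⁺ (w≢ ∘ cong suc)
  below' : ∀ w → w ≢ suc x' → T (ext R' (just x') w zero)
  below' zero    _  = _
  below' (suc w) w≢ = above-⁺ (w≢ ∘ cong suc)
  above-x' : ∀ w → w ≢ suc x → T (ext R' (just x') (image i w) (suc x'))
  above-x' w w≢ = subst (T ∘ ext R' (just x') (image i w)) swp (image-≤ i (below w w≢))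
  x↦0 : image i (suc x) ≡ zero
  x↦0 with preimage i zero
  ... | w , w↦0 with w Finₚ.≟ suc x
  ... | yes refl = w↦0
  ... | no w≢    = ⊥-elim (subst (λ z → T (ext R' (just x') z (suc x'))) w↦0 (above-x' w w≢))
  greatest : Greatest R x
  greatest a = image-≤⁻ i {suc a} {suc x} (subst (T ∘ ext R' (just x') (image i (suc a))) (sym x↦0)
    (below' (image i (suc a)) λ eq → contradiction (image-injective i (trans eq (sym swp))) λ ()))
  greatest' : Greatest R' x'
  greatest' a with preimage i (suc a)
  ... | w , w↦a = subst (λ z → T (ext R' (just x') z (suc x'))) w↦a (above-x' w λ { refl → contradiction (trans (sym w↦a) x↦0) λ () })

ext-nothing-fixes : {R R' : Rel n} {e' : Maybe (Fin n)} (i : ext R nothing ≃ ext R' e') → image i zero ≡ zero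
ext-nothing-fixes {R = R} {R'} {e'} i with preimage i zero
... | w , w↦0 = ext-zero-maximal {R = R'} {e'} (subst (λ z → T (ext R' e' z (image i zero))) w↦0 (image-≤ i (top w)))
  where
  top : ∀ w → T (ext R nothing w zero)
  top zero    = _
  top (suc _) = _

ext-nothing≇ext-just : {R R' : Rel n} {x' : Fin n} → ¬ (ext R nothing ≃ ext R' (just x'))
ext-nothing≇ext-just {x' = x'} i with ext-uncong i (ext-nothing-fixes i)
... | j , same with preimage j x'
... | a , refl = above-⁻ {x = image j a} {image j a} (subst T (same a) _) refl

ext-just-uncong : {R R' : Rel n} {x x' : Fin n} (i : ext R (just x) ≃ ext R' (just x')) → image i zero ≡ zero →
  Σ (R ≃ R') λ j → image j x ≡ x'
ext-just-uncong {x = x} {x'} i fix with ext-uncong i fix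
... | j , same = j , decidable-stable (image j x Finₚ.≟ x') λ ne →
  above-⁻ {x = x} {x} (subst T (sym (same x)) (above-⁺ ne)) refl

-- An isomorphism that moves `zero` can be corrected by `ext-swap`, since `align` makes the exempted
-- elements greatest in that case.
ext-zero-uncong : {R R' : Rel (suc n)} → Maximal R' zero → ext R (just zero) ≃ ext R' (just zero) → R ≃ R'
ext-zero-uncong {R' = R'} max' i with align i
... | inj₁ fix = proj₁ (ext-uncong i fix)
... | inj₂ (swp , _ , top') =
  proj₁ (ext-uncong (≃-trans i (ext-swap {R = R'} max' top')) (cong (image (ext-swap {R = R'} max' top')) swp))

-- The new element joins the upper part. An exempted element cannot belong to the lower part,
-- because it would lie below some `y` of the upper part although it is maximal.
cut-ext⁺ : {R : Rel n} {e : Maybe (Fin n)} → MAll.All (Maximal R) e → Cut R → Cut (ext R e)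
cut-ext⁺ {n} {R} {e} maxe (A , (x , x∈A) , (y , y∉A) , below) = A' , (suc x , x∈A) , (zero , _) , λ {a} {b} → below' {a} {b}
  where
  A' : Fin (suc n) → Bool
  A' zero    = false
  A' (suc a) = A a
  above-A : ∀ {e} → MAll.All (Maximal R) e → ∀ a → T (A a) → T (above e a)
  above-A nothing    a _   = _
  above-A (just max) a a∈A = above-⁺ λ { refl → T-not⁻ y∉A (subst (T ∘ A) (sym (max (below a∈A y∉A))) a∈A) }
  below' : ∀ {a b} → T (A' a) → T (not (A' b)) → T (ext R e a b)
  below' {suc a} {zero}  a∈ _  = above-A maxe a a∈
  below' {suc a} {suc b} a∈ b∉ = below a∈ b∉

-- The new element is maximal and so belongs to the upper part. Then `x`, which is not below it,
-- belongs there too and keeps the upper part nonempty after the removal.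
cut-ext⁻ : {R : Rel n} {x : Fin n} → Cut (ext R (just x)) → Cut R
cut-ext⁻ {n} {R} {x} (A , (a , a∈A) , (b , b∉A) , below) =
  A ∘ suc , inside a a∈A , (x , ¬⇒T-not λ x∈A → above-⁻ {x = x} {x} (below x∈A (¬⇒T-not zero∉A)) refl) , below
  where
  zero∉A : ¬ T (A zero)
  zero∉A zero∈A with ext-zero-maximal {R = R} {just x} {b} (below zero∈A b∉A)
  ... | refl = T-not⁻ b∉A zero∈A
  inside : ∀ a → T (A a) → ∃[ a' ] T (A (suc a'))
  inside zero    zero∈A = contradiction zero∈A zero∉A
  inside (suc a) a∈A    = a , a∈A

cut-top : {R : Rel (suc n)} → Cut (ext R nothing)
cut-top {n} {R} = A , (suc zero , _) , (zero , _) , λ {a} {b} → below {a} {b}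
  where
  A : Fin (suc (suc n)) → Bool
  A zero    = false
  A (suc _) = true
  below : ∀ {a b} → T (A a) → T (not (A b)) → T (ext R nothing a b)
  below {suc a} {zero} _ _ = _

-- Encoding the posets

data State : Set where
  one two three : State

-- The state after adjoining an element above everything but `zero`. From state one the two become
-- twins. From states two and three, the former second maximal element lies below the new element
-- but not below the old `zero`, which tells them apart.
next : State → State
next one   = two
next two   = three
next three = three

private
  variable
    s s' : State

-- Code n s encodes a poset on n + 1 elements.  In state one it has a greatest element, in state two
-- two maximal elements with the same elements below them, in state three two maximal elements that are
-- told apart by what lies below them.
data Code : ℕ → State → Set where
  point : Code 0 one
  top   : Code n s → Code (suc n) one
  near  : s' ≡ next s → Code n s → Code (suc n) s'
  far   : Code n three → Code (suc n) three

-- The second maximal element besides `zero`: after `near` it is the former `zero`, after `far` the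
-- former `other`.
other : Code n three → Fin (suc n)
other (near _ _) = suc zero
other (far c)    = suc (other c)

rel : Code n s → Rel (suc n)
rel point      = ext (λ ()) nothing
rel (top c)    = ext (rel c) nothing
rel (near _ c) = ext (rel c) (just zero)
rel (far c)    = ext (rel c) (just (other c))

zero-maximal : (c : Code n s) → Maximal (rel c) zero
zero-maximal point      {zero} _ = refl
zero-maximal (top c)    {zero} _ = refl
zero-maximal (near _ c) {zero} _ = refl
zero-maximal (far c)    {zero} _ = refl

other-maximal : (c : Code n three) → Maximal (rel c) (other c)
other-maximal (near _ c) = ext-suc-maximal {R = rel c} (zero-maximal c)
other-maximal (far c)    = ext-suc-maximal {R = rel c} (other-maximal c)

zero≢other : (c : Code n three) → zero ≢ other c
zero≢other (near _ c) ()
zero≢other (far c)    ()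

zero≰other : (c : Code n three) → ¬ T (rel c zero (other c))
zero≰other c t = zero≢other c (sym (zero-maximal c t))

emptyPoset : Poset 0
emptyPoset = poset (λ ()) record { reflexive = λ () ; antisym = λ () ; trans = λ () }

build : Code n s → Poset (suc n)
rel-isPoset : (c : Code n s) → IsPoset (rel c)
build c = poset (rel c) (rel-isPoset c)
rel-isPoset point      = ext-isPoset (isPoset emptyPoset) nothing
rel-isPoset (top c)    = ext-isPoset (rel-isPoset c) nothing
rel-isPoset (near _ c) = ext-isPoset (rel-isPoset c) (just (λ {y} → zero-maximal c {y}))
rel-isPoset (far c)    = ext-isPoset (rel-isPoset c) (just (λ {y} → other-maximal c {y}))

build-free : (c : Code n s) → ForbiddenFree (build c)
build-free point      = extend-free emptyPoset nothing nothing ((λ { (() , _) }) , (λ { (() , _) }))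
build-free (top c)    = extend-free (build c) nothing nothing (build-free c)
build-free (near _ c) = extend-free (build c) _ (just (λ {y} → zero-maximal c {y})) (build-free c)
build-free (far c)    = extend-free (build c) _ (just (λ {y} → other-maximal c {y})) (build-free c)

one-greatest : (c : Code n one) → Greatest (rel c) zero
one-greatest point               zero    = _
one-greatest (top c)             zero    = _
one-greatest (top c)             (suc a) = _
one-greatest (near {s = one} () c)
one-greatest (near {s = two} () c)
one-greatest (near {s = three} () c)

Encoded : Rel (suc n) → Set
Encoded {n} R = ∃[ s ] Σ (Code n s) λ c → R ≃ rel c

-- An exempted element is maximal, hence `zero` or the one other maximal element. Each choice is
-- realised by a constructor, up to isomorphism.
attach : (c : Code n s) (e : Maybe (Fin (suc n))) → MAll.All (Maximal (rel c)) e → Encoded (ext (rel c) e)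
attach c nothing _ = one , top c , ≃-refl
attach point (just zero) _ = two , near refl point , ≃-refl
attach (top c) (just zero) _ = two , near refl (top c) , ≃-refl
attach (top c) (just (suc a)) (just max) = contradiction (max {zero} _) λ ()
attach c@(near {s = s} eq c₀) (just x) (just max) with ext-maximal⁻ {R = rel c₀} max
... | inj₁ refl = _ , near refl c , ≃-refl
-- In state two the maximal elements are twins, and swapping them reduces this choice to `near`.
attach c@(near {s = one} refl c₀) (just x) _ | inj₂ refl = _ , near refl c ,
  ext-cong (ext-swap {R = rel c₀} (zero-maximal c₀) (one-greatest c₀)) (just (suc zero))
attach c@(near {s = two} refl c₀) (just x) _ | inj₂ refl = _ , far c , ≃-refl
attach c@(near {s = three} refl c₀) (just x) _ | inj₂ refl = _ , far c , ≃-refl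
attach c@(far c₀) (just x) (just max) with ext-maximal⁻ {R = rel c₀} max
... | inj₁ refl = _ , near refl c , ≃-refl
... | inj₂ refl = _ , far c , ≃-refl

free⇒encoded : (Q : Poset (suc n)) → ForbiddenFree Q → Encoded (le Q)
free⇒encoded {zero} Q _ = one , point , (↔-id _ , λ { zero zero → T-injective _ (λ _ → IsPoset.reflexive (isPoset Q) zero) })
free⇒encoded {suc n} Q free with free⇒extension Q free
... | y , e , maxe , i with free⇒encoded (Q ∖ y) (free-restrict (punchIn y) (Finₚ.punchIn-injective y _ _) Q free)
... | s , c , j with attach c (Maybe.map (image j) e) (image-maxe maxe)
  where
  image-maxe : ∀ {e} → MAll.All (Maximal (le (Q ∖ y))) e → MAll.All (Maximal (rel c)) (Maybe.map (image j) e)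
  image-maxe nothing    = nothing
  image-maxe (just max) = just (image-maximal j max)
... | s' , c' , k = s' , c' , ≃-trans (≃-sym i) (≃-trans (ext-cong j e) k)

below-zero : (c : Code n three) → ∀ {w} → w ≢ other c → T (rel c w zero)
below-zero (near _ c) {zero}  _  = _
below-zero (near _ c) {suc w} w≢ = above-⁺ (w≢ ∘ cong suc)
below-zero (far c)    {zero}  _  = _
below-zero (far c)    {suc w} w≢ = above-⁺ (w≢ ∘ cong suc)

-- Besides `zero` itself, the witness is the element exempted one step earlier in the case of
-- `near`, and the former `zero` in the case of `far`.
not-below-other : (c : Code n three) → ∃[ z ] (z ≢ zero × ¬ T (rel c z (other c)))
not-below-other (near eq (near _ c)) = suc (suc zero) , (λ ()) , λ ()
not-below-other (near eq (far c))    = suc (suc (other c)) , (λ ()) , λ t → above-⁻ {x = other c} {other c} t refl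
not-below-other (far c)              = suc zero , (λ ()) , zero≰other c

-- Only one element is not below zero, but at least two are not below other c.
no-automorphism : (c : Code n three) (i : rel c ≃ rel c) → image i zero ≢ other c
no-automorphism c i eq with not-below-other c
... | z , z≢0 , z≰ = z≢0 (trans (only z≰) (sym (only (zero≰other c))))
  where
  only : ∀ {w} → ¬ T (rel c w (other c)) → w ≡ image i (other c)
  only {w} w≰ with preimage i w
  ... | v , refl = cong (image i) (decidable-stable (v Finₚ.≟ other c) λ v≢ →
    w≰ (subst (T ∘ rel c (image i v)) eq (image-≤ i (below-zero c v≢))))

-- Strip the last step and use induction. A greatest element distinguishes `top` from the rest. If
-- one code ends in `near` and the other in `far`, `align` leaves an isomorphism of the smaller
-- posets matching `zero` with `other`; by induction it is an automorphism, and `no-automorphism`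
-- excludes it.
code-injective : (c : Code n s) (c' : Code n s') → rel c ≃ rel c' → _≡_ {A = ∃ (Code n)} (s , c) (s' , c')
code-injective point point _ = refl
code-injective (top c) (top c') i with code-injective c c' (proj₁ (ext-uncong i (ext-nothing-fixes i)))
... | refl = refl
code-injective (top _)    (near _ _) i = ⊥-elim (ext-nothing≇ext-just i)
code-injective (top _)    (far _)    i = ⊥-elim (ext-nothing≇ext-just i)
code-injective (near _ _) (top _)    i = ⊥-elim (ext-nothing≇ext-just (≃-sym i))
code-injective (far _)    (top _)    i = ⊥-elim (ext-nothing≇ext-just (≃-sym i))
code-injective (near refl c) (near refl c') i with code-injective c c' (ext-zero-uncong (zero-maximal c') i)
... | refl = refl
code-injective (far c) (far c') i with align i
... | inj₂ (_ , greatest , _) = contradiction (greatest zero) (zero≰other c)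
... | inj₁ fix with code-injective c c' (proj₁ (ext-just-uncong i fix))
... | refl = refl
code-injective (near refl c) (far c') i with align i
... | inj₂ (_ , _ , greatest') = contradiction (greatest' zero) (zero≰other c')
... | inj₁ fix with ext-just-uncong i fix
... | j , j0 with code-injective c c' j
... | refl = contradiction j0 (no-automorphism c j)
code-injective (far c) (near refl c') i with align i
... | inj₂ (_ , greatest , _) = contradiction (greatest zero) (zero≰other c)
... | inj₁ fix with ext-just-uncong i fix
... | j , jx with code-injective c c' j
... | refl = contradiction
  (trans (cong (Inverse.from (_≃_.perm j)) (sym jx)) (Inverse.strictlyInverseʳ (_≃_.perm j) _)) (no-automorphism c (≃-sym j))

-- Enumeration of the codes.

tag : Code n s → ∃ (Code n)
tag c = _ , c

ones : ∀ n → List (Code n one)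
twos : ∀ n → List (Code n two)
threes : ∀ n → List (Code n three)
codes : ∀ n → List (∃ (Code n))

ones zero    = point ∷ []
ones (suc n) = map (top ∘ proj₂) (codes n)
twos zero    = []
twos (suc n) = map (near refl) (ones n)
threes zero    = []
threes (suc n) = map (near refl) (twos n) ++ map (near refl) (threes n) ++ map far (threes n)
codes n = map tag (ones n) ++ map tag (twos n) ++ map tag (threes n)

∈-codes : (c : Code n s) → (s , c) ∈ₗ codes n
∈-ones : (c : Code n one) → c ∈ₗ ones n
∈-twos : (c : Code n two) → c ∈ₗ twos n
∈-threes : (c : Code n three) → c ∈ₗ threes n

∈-codes {s = one}   c = Memₚ.∈-++⁺ˡ (Memₚ.∈-map⁺ tag (∈-ones c))
∈-codes {n} {s = two}   c = Memₚ.∈-++⁺ʳ (map tag (ones n)) (Memₚ.∈-++⁺ˡ (Memₚ.∈-map⁺ tag (∈-twos c)))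
∈-codes {n} {s = three} c = Memₚ.∈-++⁺ʳ (map tag (ones n)) (Memₚ.∈-++⁺ʳ (map tag (twos n)) (Memₚ.∈-map⁺ tag (∈-threes c)))

∈-ones point   = here refl
∈-ones (top c) = Memₚ.∈-map⁺ (top ∘ proj₂) (∈-codes c)
∈-ones (near {s = one} () _)
∈-ones (near {s = two} () _)
∈-ones (near {s = three} () _)

∈-twos (near {s = one} refl c) = Memₚ.∈-map⁺ (near refl) (∈-ones c)
∈-twos (near {s = two} () _)
∈-twos (near {s = three} () _)

∈-threes (near {s = one} () _)
∈-threes (near {s = two} refl c) = Memₚ.∈-++⁺ˡ (Memₚ.∈-map⁺ (near refl) (∈-twos c))
∈-threes {suc n} (near {s = three} refl c) =
  Memₚ.∈-++⁺ʳ (map (near refl) (twos n)) (Memₚ.∈-++⁺ˡ (Memₚ.∈-map⁺ (near refl) (∈-threes c)))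
∈-threes {suc n} (far c) =
  Memₚ.∈-++⁺ʳ (map (near refl) (twos n)) (Memₚ.∈-++⁺ʳ (map (near refl) (threes n)) (Memₚ.∈-map⁺ far (∈-threes c)))

map-disjoint : {A B C : Set} (f : A → C) (g : B → C) → (∀ {x y} → f x ≢ g y) → ∀ {xs ys} → Disjoint (map f xs) (map g ys)
map-disjoint f g f≢g (z∈₁ , z∈₂) with Memₚ.∈-map⁻ f z∈₁ | Memₚ.∈-map⁻ g z∈₂
... | _ , _ , refl | _ , _ , eq = f≢g eq

++-disjoint : {A : Set} {xs ys zs : List A} → Disjoint xs ys → Disjoint xs zs → Disjoint xs (ys ++ zs)
++-disjoint {ys = ys} d d' (z∈₁ , z∈₂) with Memₚ.∈-++⁻ ys z∈₂
... | inj₁ z∈ys = d (z∈₁ , z∈ys)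
... | inj₂ z∈zs = d' (z∈₁ , z∈zs)

near-injective : {c c' : Code n s} {eq : s' ≡ next s} → near eq c ≡ near eq c' → c ≡ c'
near-injective refl = refl

far-injective : {c c' : Code n three} → far c ≡ far c' → c ≡ c'
far-injective refl = refl

codes-unique : ∀ n → Unique (codes n)
ones-unique : ∀ n → Unique (ones n)
twos-unique : ∀ n → Unique (twos n)
threes-unique : ∀ n → Unique (threes n)

codes-unique n = Uniqueₚ.++⁺ (Uniqueₚ.map⁺ (λ { refl → refl }) (ones-unique n))
  (Uniqueₚ.++⁺ (Uniqueₚ.map⁺ (λ { refl → refl }) (twos-unique n)) (Uniqueₚ.map⁺ (λ { refl → refl }) (threes-unique n))
    (map-disjoint tag tag (λ ())))
  (++-disjoint {xs = map tag (ones n)} {map tag (twos n)}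
    (map-disjoint tag tag (λ ())) (map-disjoint tag tag (λ ())))

ones-unique zero    = [] ∷ []
ones-unique (suc n) = Uniqueₚ.map⁺ (λ { {_ , _} {_ , _} refl → refl }) (codes-unique n)

twos-unique zero    = []
twos-unique (suc n) = Uniqueₚ.map⁺ near-injective (ones-unique n)

threes-unique zero    = []
threes-unique (suc n) = Uniqueₚ.++⁺ (Uniqueₚ.map⁺ near-injective (twos-unique n))
  (Uniqueₚ.++⁺ (Uniqueₚ.map⁺ near-injective (threes-unique n)) (Uniqueₚ.map⁺ far-injective (threes-unique n))
    (map-disjoint (near refl) far λ ()))
  (++-disjoint {xs = map (near refl) (twos n)} {map (near refl) (threes n)}
    (map-disjoint (near {s = two} refl) (near {s = three} refl) λ ()) (map-disjoint (near {s = two} refl) far λ ()))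

-- Distinct codes give nonisomorphic posets by `code-injective`, so counting isomorphism classes
-- becomes counting codes.
isoClassCount : {P : Poset (suc n) → Set} (cs : List (∃ (Code n))) → Unique cs → All (P ∘ build ∘ proj₂) cs →
  (∀ Q → P Q → ∃[ c ] (c ∈ₗ cs × le Q ≃ rel (proj₂ c))) → IsoClassCount (suc n) P (length cs)
isoClassCount cs unique sound complete = map (build ∘ proj₂) cs , length-map _ cs , Allₚ.map⁺ sound
  , AllPairsₚ.map⁺ (AllPairs.map (λ c≢c' i → c≢c' (code-injective _ _ (≅⇒≃ i))) unique)
  , λ Q PQ → let c , c∈ , i = complete Q PQ in Anyₚ.map⁺ (Any.map (λ { refl → ≃⇒≅ i }) c∈)

-- The first three are the level sizes of the tree of codes by state. As `Code n` describes posets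
-- on `n + 1` elements, `#free` is shifted by one, with the empty poset at 0.
#ones #twos #threes #free : ℕ → ℕ
#ones zero      = 1
#ones (suc n)   = #ones n + (#twos n + #threes n)
#twos zero      = 0
#twos (suc n)   = #ones n
#threes zero    = 0
#threes (suc n) = #twos n + (#threes n + #threes n)
#free zero      = 1
#free (suc n)   = #ones n + (#twos n + #threes n)

length-codes : ∀ n → length (codes n) ≡ #free (suc n)
length-ones : ∀ n → length (ones n) ≡ #ones n
length-twos : ∀ n → length (twos n) ≡ #twos n
length-threes : ∀ n → length (threes n) ≡ #threes n

length-codes n = trans (length-++ (map tag (ones n))) (cong₂ _+_ (trans (length-map tag (ones n)) (length-ones n))
  (trans (length-++ (map tag (twos n))) (cong₂ _+_ (trans (length-map tag (twos n)) (length-twos n))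
    (trans (length-map tag (threes n)) (length-threes n)))))

length-ones zero    = refl
length-ones (suc n) = trans (length-map _ (codes n)) (length-codes n)

length-twos zero    = refl
length-twos (suc n) = trans (length-map _ (ones n)) (length-ones n)

length-threes zero    = refl
length-threes (suc n) = trans (length-++ (map (near refl) (twos n)))
  (cong₂ _+_ (trans (length-map _ (twos n)) (length-twos n))
    (trans (length-++ (map (near refl) (threes n)))
      (cong₂ _+_ (trans (length-map _ (threes n)) (length-threes n)) (trans (length-map _ (threes n)) (length-threes n)))))

free-count : ∀ n → IsoClassCount n ForbiddenFree (#free n)
free-count zero = emptyPoset ∷ [] , refl , ((λ { (() , _) }) , (λ { (() , _) })) ∷ [] , [] ∷ []
  , λ Q _ → here (↔-id _ , λ ())
free-count (suc n) = subst (IsoClassCount (suc n) ForbiddenFree) (length-codes n)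
  (isoClassCount (codes n) (codes-unique n) (All.tabulate λ {c} _ → build-free (proj₂ c))
    λ Q free → let s , c , i = free⇒encoded Q free in (s , c) , ∈-codes c , i)

-- Posets that are not nontrivial ordinal sums.

irreducibles : ∀ n → List (Code (2 + n) three)
irreducibles zero    = near refl (near refl point) ∷ []
irreducibles (suc n) = map (near refl) (irreducibles n) ++ map far (irreducibles n)

irreducibles-unique : ∀ n → Unique (irreducibles n)
irreducibles-unique zero    = [] ∷ []
irreducibles-unique (suc n) = Uniqueₚ.++⁺
  (Uniqueₚ.map⁺ near-injective (irreducibles-unique n)) (Uniqueₚ.map⁺ far-injective (irreducibles-unique n))
  (map-disjoint (near refl) far λ ())

-- On three elements there is a single code without `top`; every further element offers the choice
-- between `near` and `far`. Here `n` is the number of elements minus three.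
length-irreducibles : ∀ n → length (irreducibles n) ≡ 2 ^ n
length-irreducibles zero    = refl
length-irreducibles (suc n) = trans (length-++ (map (near refl) (irreducibles n)))
  (cong₂ _+_ (trans (length-map _ (irreducibles n)) ih)
    (trans (trans (length-map _ (irreducibles n)) ih) (sym (ℕₚ.+-identityʳ (2 ^ n)))))
  where ih = length-irreducibles n

point-uncut : ¬ Cut (rel point)
point-uncut (A , (zero , z∈) , (zero , z∉) , _) = T-not⁻ z∉ z∈

irreducible-uncut : ∀ n {c} → c ∈ₗ irreducibles n → ¬ Cut (rel c)
irreducible-uncut zero (here refl) = point-uncut ∘ cut-ext⁻ ∘ cut-ext⁻
irreducible-uncut (suc n) c∈ with Memₚ.∈-++⁻ (map (near refl) (irreducibles n)) c∈
... | inj₁ c∈near with Memₚ.∈-map⁻ (near refl) c∈near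
... | c' , c'∈ , refl = irreducible-uncut n c'∈ ∘ cut-ext⁻
irreducible-uncut (suc n) c∈ | inj₂ c∈far with Memₚ.∈-map⁻ far c∈far
... | c' , c'∈ , refl = irreducible-uncut n c'∈ ∘ cut-ext⁻

cut-near : (c : Code n s) {eq : s' ≡ next s} → Cut (rel c) → Cut (rel (near eq c))
cut-near c = cut-ext⁺ (just (λ {y} → zero-maximal c {y}))

cut-far : (c : Code n three) → Cut (rel c) → Cut (rel (far c))
cut-far c = cut-ext⁺ (just (λ {y} → other-maximal c {y}))

-- A `top` step creates a cut and `near` and `far` preserve cuts, so an uncut code never uses `top`.
uncut⇒irreducible : ∀ n (c : Code (2 + n) s) → ¬ Cut (rel c) → (s , c) ∈ₗ map tag (irreducibles n)
uncut⇒irreducible n (top c) uncut = contradiction cut-top uncut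
uncut⇒irreducible zero (near refl (top c)) uncut = contradiction (cut-near (top c) {refl} cut-top) uncut
uncut⇒irreducible zero (near refl (near refl point)) uncut = here refl
uncut⇒irreducible zero (far (near () point)) uncut
uncut⇒irreducible (suc n) (near refl c) uncut
  with Memₚ.∈-map⁻ tag (uncut⇒irreducible n c (uncut ∘ cut-near c {refl}))
... | c' , c'∈ , refl = Memₚ.∈-map⁺ tag (Memₚ.∈-++⁺ˡ (Memₚ.∈-map⁺ (near refl) c'∈))
uncut⇒irreducible (suc n) (far c) uncut
  with Memₚ.∈-map⁻ tag (uncut⇒irreducible n c (uncut ∘ cut-far c))
... | c' , c'∈ , refl = Memₚ.∈-map⁺ tag (Memₚ.∈-++⁺ʳ (map (near refl) (irreducibles n)) (Memₚ.∈-map⁺ far c'∈))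

indecomposable-count : (cs : List (∃ (Code n))) → Unique cs → (∀ {c} → c ∈ₗ cs → ¬ Cut (rel (proj₂ c))) →
  (∀ {s} (c : Code n s) → ¬ Cut (rel c) → (s , c) ∈ₗ cs) → IsoClassCount (suc n) NotOrdinalSumCond (length cs)
indecomposable-count cs unique sound complete = isoClassCount cs unique
  (All.tabulate λ {c} c∈ → build-free (proj₂ c) , sound c∈ ∘ ordinalSum⇒cut (build (proj₂ c)))
  λ Q (free , notSum) → let s , c , i = free⇒encoded Q free in
    (s , c) , complete c (λ cut → notSum (transport {Q} {build c} i (cut⇒ordinalSum (build c) cut))) , i
  where
  transport : ∀ {Q Q' : Poset (suc _)} → le Q ≃ le Q' → IsNontrivialOrdinalSum Q' → IsNontrivialOrdinalSum Q
  transport i (m , k , Q₁ , Q₂ , j) = m , k , Q₁ , Q₂ , ≃⇒≅ (≃-trans (≅⇒≃ j) (≃-sym i))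

indecomposable-count₁ : IsoClassCount 1 NotOrdinalSumCond 1
indecomposable-count₁ = indecomposable-count ((one , point) ∷ []) ([] ∷ []) (λ { (here refl) → point-uncut })
  λ { point _ → here refl }

indecomposable-count₂ : IsoClassCount 2 NotOrdinalSumCond 1
indecomposable-count₂ = indecomposable-count ((two , near refl point) ∷ []) ([] ∷ [])
  (λ { (here refl) → point-uncut ∘ cut-ext⁻ })
  λ { (top c) uncut → contradiction cut-top uncut ; (near refl point) _ → here refl }

indecomposable-count₃ : ∀ n → 3 ≤ n → IsoClassCount n NotOrdinalSumCond (2 ^ (n ∸ 3))
indecomposable-count₃ (suc (suc (suc n))) (s≤s (s≤s (s≤s z≤n))) = subst (IsoClassCount (3 + n) NotOrdinalSumCond)
  (trans (length-map _ (irreducibles n)) (length-irreducibles n))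
  (indecomposable-count (map tag (irreducibles n)) (Uniqueₚ.map⁺ (λ { refl → refl }) (irreducibles-unique n))
    sound (uncut⇒irreducible n))
  where
  sound : ∀ {c} → c ∈ₗ map tag (irreducibles n) → ¬ Cut (rel (proj₂ c))
  sound c∈ with Memₚ.∈-map⁻ tag c∈
  ... | c' , c'∈ , refl = irreducible-uncut n c'∈

-- The generating function

convolve : Series → Series → ℕ → ℕ → ℤ
convolve F G zero    N = F 0 ℤ.* G N
convolve F G (suc k) N = convolve F G k N ℤ.+ F (suc k) ℤ.* G (N ∸ suc k)

-- The local function summing up F *ₛ G in Defs has no accessible name, so unification has to find it:
-- abstracting N and _+_ in the unfolded goal leaves it applied to distinct variables.
module _ (F G : Series) where
  mutual
    partialSum : ℕ → ℕ → ℤ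
    partialSum = _

    *ₛ≡convolve : ∀ N → (F *ₛ G) N ≡ convolve F G N N
    *ₛ≡convolve zero = refl
    *ₛ≡convolve (suc n) with suc n | ℤ._+_
    ... | N | _⊞_ = cong₂ _⊞_ (partialSum≡convolve n N) refl

    partialSum≡convolve : ∀ k N → partialSum k N ≡ convolve F G k N
    partialSum≡convolve zero    N = refl
    partialSum≡convolve (suc k) N = cong (ℤ._+ F (suc k) ℤ.* G (N ∸ suc k)) (partialSum≡convolve k N)

convolve-zero : ∀ {F G : Series} k N → (∀ i → i ≤ k → F i ℤ.* G (N ∸ i) ≡ + 0) → convolve F G k N ≡ + 0
convolve-zero zero    N vanish = vanish 0 z≤n
convolve-zero (suc k) N vanish =
  cong₂ ℤ._+_ (convolve-zero k N λ i i≤k → vanish i (ℕₚ.m≤n⇒m≤1+n i≤k)) (vanish (suc k) ℕₚ.≤-refl)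

-- Expanded, this is 1 - 3x + x² + x³.
denominator : Series
denominator = poly (+ 1 ∷ - (+ 1) ∷ []) *ₛ poly (+ 1 ∷ - (+ 2) ∷ - (+ 1) ∷ [])

denominator-vanishes : ∀ j → denominator (4 + j) ≡ + 0
denominator-vanishes j = trans (*ₛ≡convolve p q (4 + j)) (convolve-zero (4 + j) (4 + j) term)
  where
  p q : Series
  p = poly (+ 1 ∷ - (+ 1) ∷ [])
  q = poly (+ 1 ∷ - (+ 2) ∷ - (+ 1) ∷ [])
  term : ∀ i → i ≤ 4 + j → p i ℤ.* q (4 + j ∸ i) ≡ + 0
  term 0             _ = refl
  term 1             _ = refl
  term (suc (suc i)) _ = refl

-- The coefficients of the denominator, arranged without subtraction. All four counts are linear in
-- the three level sizes at `n`, which leaves an identity in three variables.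
#free-recurrence : ∀ n → #free (4 + n) + (#free (2 + n) + #free (1 + n)) ≡ 3 ℕ.* #free (3 + n)
#free-recurrence n = identity (#ones n) (#twos n) (#threes n)
  where
  identity : ∀ a b c →
    let t₁ = a + (b + c) ; c₁ = b + (c + c)
        t₂ = t₁ + (a + c₁) ; c₂ = a + (c₁ + c₁)
        t₃ = t₂ + (t₁ + c₂) ; c₃ = t₁ + (c₂ + c₂)
        t₄ = t₃ + (t₂ + c₃)
    in t₄ + (t₂ + t₁) ≡ 3 ℕ.* t₃
  identity = ℕ-Solver.solve-∀

generatingFunction : ∀ N → ((λ k → + #free k) *ₛ denominator) N ≡ poly (+ 1 ∷ - (+ 2) ∷ []) N
generatingFunction 0 = refl
generatingFunction 1 = refl
generatingFunction 2 = refl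
generatingFunction 3 = refl
-- Only the last four terms of the convolution meet a nonzero coefficient of the denominator: for an
-- index up to `n`, the complementary index is at least 4.
generatingFunction (suc (suc (suc (suc n)))) = begin
  (F *ₛ denominator) (4 + n)
    ≡⟨ *ₛ≡convolve F denominator (4 + n) ⟩
  convolve F denominator n (4 + n) ℤ.+ term 1 ℤ.+ term 2 ℤ.+ term 3 ℤ.+ term 4
    ≡⟨ cong₂ ℤ._+_ (cong₂ ℤ._+_ (cong₂ ℤ._+_ (cong₂ ℤ._+_ low (at 1 3 refl)) (at 2 2 refl)) (at 3 1 refl)) (at 4 0 refl) ⟩
  + 0 ℤ.+ F (1 + n) ℤ.* + 1 ℤ.+ F (2 + n) ℤ.* + 1 ℤ.+ F (3 + n) ℤ.* - (+ 3) ℤ.+ F (4 + n) ℤ.* + 1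
    ≡⟨ collect (F (1 + n)) (F (2 + n)) (F (3 + n)) (F (4 + n)) ⟩
  (F (4 + n) ℤ.+ (F (2 + n) ℤ.+ F (1 + n))) ℤ.- + 3 ℤ.* F (3 + n)
    ≡⟨ cong₂ ℤ._-_ (cong +_ (#free-recurrence n)) (sym (ℤₚ.pos-* 3 (#free (3 + n)))) ⟩
  + (3 ℕ.* #free (3 + n)) ℤ.- + (3 ℕ.* #free (3 + n))
    ≡⟨ ℤₚ.+-inverseʳ (+ (3 ℕ.* #free (3 + n))) ⟩
  + 0 ∎
  where
  open ≡-Reasoning
  F : Series
  F k = + #free k
  term : ℕ → ℤ
  term k = F (k + n) ℤ.* denominator (4 + n ∸ (k + n))
  at : ∀ k j → k + j ≡ 4 → term k ≡ F (k + n) ℤ.* denominator j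
  at k j eq = cong (λ i → F (k + n) ℤ.* denominator i)
    (trans (cong (λ s → s + n ∸ (k + n)) (trans (sym eq) (ℕₚ.+-comm k j)))
      (trans (cong (_∸ (k + n)) (ℕₚ.+-assoc j k n)) (ℕₚ.m+n∸n≡m j (k + n))))
  low : convolve F denominator n (4 + n) ≡ + 0
  low = convolve-zero n (4 + n) λ i i≤n → trans
    (cong (λ j → F i ℤ.* denominator j) (ℕₚ.+-∸-assoc 4 i≤n))
    (trans (cong (λ d → F i ℤ.* d) (denominator-vanishes (n ∸ i))) (ℤₚ.*-zeroʳ (F i)))
  collect : ∀ x y z w → + 0 ℤ.+ x ℤ.* + 1 ℤ.+ y ℤ.* + 1 ℤ.+ z ℤ.* - (+ 3) ℤ.+ w ℤ.* + 1
    ≡ (w ℤ.+ (y ℤ.+ x)) ℤ.- + 3 ℤ.* z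
  collect = ℤ-Solver.solve-∀

theorem3p4 : (∀ (n : ℕ) (Q : Poset n) →
    (MultiplicityFree Q ⇔ AtMostTwoPerRank Q)
    × (AtMostTwoPerRank Q ⇔ ForbiddenFree Q)
    × (MultiplicityFree Q → ∀ (S : Subset (n ∸ 1)) → ¬ (flagH Q S ≡ + 0) → Sparse S))
    × (Σ (ℕ → ℕ) λ f →
    (∀ (n : ℕ) → IsoClassCount n ForbiddenFree (f n))
    × (∀ (N : ℕ) →
    ((λ k → + f k) *ₛ (poly (+ 1 ∷ - (+ 1) ∷ []) *ₛ poly (+ 1 ∷ - (+ 2) ∷ - (+ 1) ∷ []))) N
    ≡ poly (+ 1 ∷ - (+ 2) ∷ []) N))
    × (∀ (n : ℕ) (Q : Poset n) → ForbiddenFree Q →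
    ((¬ IsNontrivialOrdinalSum Q) ⇔ (∀ (i : ℕ) → 1 ≤ i → i ≤ n ∸ 1 → rankCount Q i ≡ 2)))
    × IsoClassCount 1 NotOrdinalSumCond 1
    × IsoClassCount 2 NotOrdinalSumCond 1
    × (∀ (n : ℕ) → 3 ≤ n → IsoClassCount n NotOrdinalSumCond (2 ^ (n ∸ 3)))
theorem3p4 =
  (λ n Q → multiplicityFree⇔atMostTwo Q , atMostTwo⇔forbiddenFree Q , multiplicityFree⇒sparse Q)
  , (#free , free-count , generatingFunction)
  , (λ n Q → indecomposable⇔two Q)
  , indecomposable-count₁
  , indecomposable-count₂
  , indecomposable-count₃
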